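{- Let $\lambda$ be a partition and $h_1,\dots,h_s$ rim-hooks of $\lambda$ with $h_i\le h_{i+1}$ for all $i\in[s-1]$. Then for all $i\in[s]$, $h_i$ inserts into $h_{i+1}*\cdots*h_s*0$, and the minimum of $\mathrm{cand}(h_i*\cdots*h_s*0)$ with respect to the content order is $\alpha(P(h_i,h_{i+1}*\cdots*h_s*0))$.
   Context: Cells are pairs $(i,j)\in\mathbb Z^2$; $\mathrm n(i,j)=(i-1,j)$, $\mathrm e(i,j)=(i,j+1)$, $\mathrm s(i,j)=(i+1,j)$, $\mathrm w(i,j)=(i,j-1)$. A partition $\lambda$ is identified with its Young diagram; $\lambda'$ is its conjugate. A reverse plane partition of shape $\lambda$ is $\pi:\lambda\to\mathbb N$ with $\pi(u)\le\pi(\mathrm e u),\pi(\mathrm s u)$, with conventions $\pi(i,j)=0$ if $i\le0$ or $j\le0$, $\pi(i,j)=\infty$ if $i,j\ge1$, $(i,j)\notin\lambda$; $0$ denotes the zero reverse plane partition of shape $\lambda$. Content $c(i,j)=j-i$; outer corner: $u\in\lambda$, $\mathrm e u,\mathrm s u\notin\lambda$; inner corner: $\mathrm e u,\mathrm s u\in\lambda$, $\mathrm e\mathrm s u\notin\lambda$. With inner corner contents $i_1<\dots<i_r$ and outer corner contents $o_1<\dots<o_{r+1}$ (interlacing), $\mathcal I=\{u\in\lambda:c(u)=i_k\}$, $\mathcal O=\{u\in\lambda:c(u)=o_k\}$, $\mathcal A=\{u\in\lambda:c(u)<o_1\text{ or }i_k<c(u)<o_{k+1}\text{ for some }k\in[r]\}$,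 $\mathcal B=\{u\in\lambda:o_k<c(u)<i_k\text{ for some }k\in[r]\text{ or }c(u)>o_{r+1}\}$. Content order: $(i,j)\trianglelefteq(k,l)$ iff $j-i>l-k$, or $j-i=l-k$ and $i\ge k$. Candidates: $\mathrm{cand}(\pi)=\{u\in\mathcal O:\pi(u)>\pi(\mathrm w u)\}\cup\{u\in\mathcal A:\pi(u)>\pi(\mathrm w u),\pi(u)>\pi(\mathrm n u)\}$. North-east path: $(u_0,\dots,u_s)$ in $\lambda$, $u_k\in\{\mathrm n u_{k-1},\mathrm e u_{k-1}\}$, length $s$, head $\alpha=u_0$, tail $\omega=u_s$. South-west path: $(v_0,\dots,v_s)$, $v_k\in\{\mathrm s v_{k-1},\mathrm w v_{k-1}\}$, length $s$, $\alpha=v_s$, $\omega=v_0$. Rim-hook: north-east path $h$ with $\mathrm s\alpha(h)\notin\lambda$, $\mathrm e\omega(h)\notin\lambda$, $\mathrm e\mathrm s u\notin\lambda$ for all $u\in h$; for $u=(i,j)\in\lambda$, $h^u$ is the rim-hook from $(\lambda'_j,j)$ to $(i,\lambda_i)$, and these are all rim-hooks. Reverse lexicographic order on cells: $(i,j)\le(k,l)$ iff $j>l$, or $j=l$ and $i\ge k$; rim-hooks ordered by $h^u\le h^v$ iff $u\le v$. $(\pi+P)(u)=\pi(u)+1$ for $u\in P$, else $\pi(u)$. $(P,\pi)$ compatible: $u\in P\cap(\mathcal I\cup\mathcal A)$ implies $\mathrm e u\in P$ and $\pi(u)=\pi(\mathrm e u)$; $u,\mathrm s u\in P$ implies $\pi(u)=\pi(\mathrm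 s u)$. $h$ inserts into $\pi$ if some path $P$ has $\omega(P)=\omega(h)$, $\ell(P)=\ell(h)$, $(P,\pi)$ compatible and $\pi+P$ a reverse plane partition; then $h*\pi=\pi+P(h,\pi)$, with $P(h,\pi)$ the south-west path starting at $\omega(h)$ which, while its length is less than $\ell(h)$, moves from current cell $u$ to $\mathrm s u$ if $u\in\mathcal B\cup\mathcal I$ and $\pi(u)=\pi(\mathrm s u)$, and to $\mathrm w u$ otherwise. Iterated insertion is read right to left: $h_i*\cdots*h_s*0=h_i*(\cdots(h_s*0))$. -}

module Defs where

open import Data.Bool using (Bool; true; false; _∧_; _∨_; not; if_then_else_; T)
open import Data.Nat as ℕ using (ℕ; zero; suc; _+_; _∸_; _≡ᵇ_; _≤ᵇ_)
open import Data.Integer as ℤ using (ℤ; +_; _-_)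
import Data.Integer.Properties as ℤP
open import Data.List using (List; []; _∷_; map; concatMap; length; reverse; filterᵇ; upTo)
open import Data.Bool.ListAction using (any)
open import Data.List.Relation.Unary.All using (All)
open import Data.List.Relation.Unary.Linked using (Linked)
open import Data.List.Membership.Propositional using (_∈_)
open import Data.Maybe using (Maybe; just; nothing)
open import Data.Product using (_×_; _,_; ∃; ∃-syntax; proj₁; proj₂)
open import Data.Sum using (_⊎_)
open import Data.Empty using (⊥)
open import Data.Unit using (⊤)
open import Relation.Nullary using (does)
open import Relation.Binary.PropositionalEquality using (_≡_)
import Data.List.Sort

open Data.List.Sort ℤP.≤-decTotalOrder using (sort)

IsPartition : List ℕ → Set
IsPartition sh = Linked ℕ._≥_ sh × All (λ p → 1 ℕ.≤ p) sh

-- λ_i (1-indexed); 0 if i = 0 or i > ℓ(λ)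
part : List ℕ → ℕ → ℕ
part []       _             = 0
part (x ∷ xs) zero          = 0
part (x ∷ xs) (suc zero)    = x
part (x ∷ xs) (suc (suc i)) = part xs (suc i)

conj : List ℕ → ℕ → ℕ
conj []       j = 0
conj (x ∷ xs) j = (if j ≤ᵇ x then 1 else 0) + conj xs j

-- Cells.  Cells (i,j) with i,j ≥ 1 are the ones that can lie in λ;
-- since we only apply n, w to cells of λ, ℕ × ℕ suffices
-- (n (1,j) = (0,j), w (i,1) = (i,0) lie on the boundary).

Cell : Set
Cell = ℕ × ℕ

nC eC sC wC : Cell → Cell
nC (i , j) = (i ∸ 1 , j)
eC (i , j) = (i , suc j)
sC (i , j) = (suc i , j)
wC (i , j) = (i , j ∸ 1)

inλᵇ : List ℕ → Cell → Bool
inλᵇ sh (i , j) = (1 ≤ᵇ i) ∧ (1 ≤ᵇ j) ∧ (j ≤ᵇ part sh i)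

_∈λ_ : Cell → List ℕ → Set
u ∈λ sh = T (inλᵇ sh u)

_∉λ_ : Cell → List ℕ → Set
u ∉λ sh = T (not (inλᵇ sh u))

content : Cell → ℤ
content (i , j) = + j - + i

from1 : ℕ → List ℕ
from1 n = map suc (upTo n)

cells : List ℕ → List Cell
cells sh = concatMap (λ i → map (λ j → (i , j)) (from1 (part sh i))) (from1 (length sh))

outerᵇ : List ℕ → Cell → Bool
outerᵇ sh u = inλᵇ sh u ∧ not (inλᵇ sh (eC u)) ∧ not (inλᵇ sh (sC u))

innerᵇ : List ℕ → Cell → Bool
innerᵇ sh u = inλᵇ sh (eC u) ∧ inλᵇ sh (sC u) ∧ not (inλᵇ sh (eC (sC u)))

-- contents of inner corners i₁ < … < i_r, and outer corners o₁ < … < o_{r+1}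
innerContents : List ℕ → List ℤ
innerContents sh = sort (map content (filterᵇ (innerᵇ sh) (cells sh)))

outerContents : List ℕ → List ℤ
outerContents sh = sort (map content (filterᵇ (outerᵇ sh) (cells sh)))

nth : List ℤ → ℕ → Maybe ℤ
nth []       _       = nothing
nth (x ∷ xs) zero    = just x
nth (x ∷ xs) (suc k) = nth xs k

_<ᶻ_ : ℤ → ℤ → Bool
a <ᶻ b = does (a ℤ.<? b)

_≡ᶻ_ : ℤ → ℤ → Bool
a ≡ᶻ b = does (a ℤ.≟ b)

between : Maybe ℤ → Maybe ℤ → ℤ → Bool
between (just a) (just b) c = (a <ᶻ c) ∧ (c <ᶻ b)
between _        _        c = false

below : ℤ → Maybe ℤ → Bool
below c (just b) = c <ᶻ b
below c nothing  = false

above : ℤ → Maybe ℤ → Bool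
above c (just a) = a <ᶻ c
above c nothing  = false

elemᶻ : ℤ → List ℤ → Bool
elemᶻ c xs = any (λ x → c ≡ᶻ x) xs

isI : List ℕ → Cell → Bool
isI sh u = inλᵇ sh u ∧ elemᶻ (content u) (innerContents sh)

isO : List ℕ → Cell → Bool
isO sh u = inλᵇ sh u ∧ elemᶻ (content u) (outerContents sh)

-- A = {u ∈ λ : c(u) < o₁, or i_k < c(u) < o_{k+1} for some k ∈ [r]}
-- (0-indexed: i_{k+1} = nth is k, o_{k+2} = nth os (k+1), k < r)
isA : List ℕ → Cell → Bool
isA sh u = inλᵇ sh u ∧
  (below (content u) (nth os 0)
   ∨ any (λ k → between (nth is k) (nth os (suc k)) (content u)) (upTo (length is)))
  where
  is = innerContents sh
  os = outerContents sh

isB : List ℕ → Cell → Bool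
isB sh u = inλᵇ sh u ∧
  (any (λ k → between (nth os k) (nth is k) (content u)) (upTo (length is))
   ∨ above (content u) (nth os (length is)))
  where
  is = innerContents sh
  os = outerContents sh

data Val : Set where
  fin : ℕ → Val
  ∞   : Val

val : List ℕ → (Cell → ℕ) → Cell → Val
val sh π (i , j) =
  if (i ≡ᵇ 0) ∨ (j ≡ᵇ 0) then fin 0
  else (if inλᵇ sh (i , j) then fin (π (i , j)) else ∞)

_≤∞_ : Val → Val → Set
fin a ≤∞ fin b = a ℕ.≤ b
fin a ≤∞ ∞     = ⊤
∞     ≤∞ fin b = ⊥
∞     ≤∞ ∞     = ⊤

_<∞_ : Val → Val → Set
fin a <∞ fin b = a ℕ.< b
fin a <∞ ∞     = ⊤
∞     <∞ _     = ⊥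

_≡∞ᵇ_ : Val → Val → Bool
fin a ≡∞ᵇ fin b = a ≡ᵇ b
∞     ≡∞ᵇ ∞     = true
_     ≡∞ᵇ _     = false

-- reverse plane partitions of shape λ: only the values on λ matter
IsRPP : List ℕ → (Cell → ℕ) → Set
IsRPP sh π = ∀ u → u ∈λ sh →
  (val sh π u ≤∞ val sh π (eC u)) × (val sh π u ≤∞ val sh π (sC u))

zeroRPP : Cell → ℕ
zeroRPP _ = 0

_⊴_ : Cell → Cell → Set
u ⊴ v = (content v ℤ.< content u) ⊎ ((content u ≡ content v) × (proj₁ v ℕ.≤ proj₁ u))

Cand : List ℕ → (Cell → ℕ) → Cell → Set
Cand sh π u =
    (T (isO sh u) × (val sh π (wC u) <∞ fin (π u)))
  ⊎ (T (isA sh u) × (val sh π (wC u) <∞ fin (π u)) × (val sh π (nC u) <∞ fin (π u)))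

IsMinCand : List ℕ → (Cell → ℕ) → Cell → Set
IsMinCand sh π u = Cand sh π u × (∀ v → Cand sh π v → u ⊴ v)

-- Paths.  A path is the list of its cells in north-east order
-- (u₀, …, u_s); a south-west path (v₀,…,v_s) is the same object read
-- backwards.  α = first cell, ω = last cell, length = s.

data NEPath (sh : List ℕ) : List Cell → Set where
  single : ∀ {u} → u ∈λ sh → NEPath sh (u ∷ [])
  step   : ∀ {u v rest} → u ∈λ sh → (v ≡ nC u ⊎ v ≡ eC u) →
           NEPath sh (v ∷ rest) → NEPath sh (u ∷ v ∷ rest)

headC : List Cell → Cell
headC []      = (0 , 0)
headC (u ∷ _) = u

lastC : List Cell → Cell
lastC []           = (0 , 0)
lastC (u ∷ [])     = u
lastC (_ ∷ v ∷ us) = lastC (v ∷ us)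

α : List Cell → Cell
α = headC

ω : List Cell → Cell
ω = lastC

ℓ : List Cell → ℕ
ℓ p = length p ∸ 1

IsRimHook : List ℕ → List Cell → Set
IsRimHook sh h = NEPath sh h × sC (α h) ∉λ sh × eC (ω h) ∉λ sh ×
  (∀ u → u ∈ h → eC (sC u) ∉λ sh)

IsHookOf : List ℕ → Cell → List Cell → Set
IsHookOf sh (i , j) h = α h ≡ (conj sh j , j) × ω h ≡ (i , part sh i)

_≤rl_ : Cell → Cell → Set
(i , j) ≤rl (k , l) = (l ℕ.< j) ⊎ ((j ≡ l) × (k ℕ.≤ i))

_≤[_]ʰ_ : List Cell → List ℕ → List Cell → Set
h ≤[ sh ]ʰ h' = ∃[ u ] ∃[ v ] (u ∈λ sh × v ∈λ sh × IsHookOf sh u h × IsHookOf sh v h' × u ≤rl v)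

memb : Cell → List Cell → Bool
memb u [] = false
memb (i , j) ((k , l) ∷ ps) = ((i ≡ᵇ k) ∧ (j ≡ᵇ l)) ∨ memb (i , j) ps

_+P_ : (Cell → ℕ) → List Cell → (Cell → ℕ)
(π +P P) u = π u + (if memb u P then 1 else 0)

Compatible : List ℕ → List Cell → (Cell → ℕ) → Set
Compatible sh P π =
  (∀ u → u ∈ P → T (isI sh u ∨ isA sh u) → (eC u ∈ P) × (π u ≡ π (eC u))) ×
  (∀ u → u ∈ P → sC u ∈ P → π u ≡ π (sC u))

Inserts : List ℕ → List Cell → (Cell → ℕ) → Set
Inserts sh h π = ∃[ P ] (NEPath sh P × ω P ≡ ω h × ℓ P ≡ ℓ h ×
  Compatible sh P π × IsRPP sh (π +P P))

swRule : List ℕ → (Cell → ℕ) → ℕ → Cell → List Cell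
swRule sh π zero    u = u ∷ []
swRule sh π (suc n) u =
  u ∷ swRule sh π n
    (if (isB sh u ∨ isI sh u) ∧ (val sh π u ≡∞ᵇ val sh π (sC u)) then sC u else wC u)

-- P(h, π), listed in north-east order
insPath : List ℕ → List Cell → (Cell → ℕ) → List Cell
insPath sh h π = reverse (swRule sh π (ℓ h) (ω h))

_*[_]_ : List Cell → List ℕ → (Cell → ℕ) → (Cell → ℕ)
h *[ sh ] π = π +P insPath sh h π

insAll : List ℕ → List (List Cell) → (Cell → ℕ)
insAll sh []       = zeroRPP
insAll sh (h ∷ hs) = h *[ sh ] insAll sh hs

{-# OPTIONS --safe #-}

-- Read along its diagonals, a reverse plane partition is a sequence of partitions in which
-- neighbouring ones interlace, and inserting a rim-hook adds one box to each partition on an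
-- interval of contents.  Inserting in the given order, the contents of the heads weakly increase,
-- and the following is preserved: where the rim makes an east step beyond the current head, the two
-- neighbouring partitions agree.  Consequently the insertion path is compatible, each box it adds is
-- addable, and there are no candidates of content greater than that of the head.  Two consecutive
-- hooks with the same head insert along non-crossing paths, the later one weakly south-east of the
-- earlier one; hence on the diagonal of the head the newest candidate is the southernmost.  A path
-- for a hook with head in column b stays among the b cells closest to the rim on each diagonal,
-- which keeps it inside λ.
module Submission where

open import Defs
open import Data.Bool using (Bool; true; false; _∧_; _∨_; not; if_then_else_; T)
open import Data.Bool.ListAction using (any)
open import Data.Bool.Properties using (∨-assoc; T-∧; T-∨; T-≡; T?)
open import Data.Empty using (⊥; ⊥-elim)
open import Data.Fin using (Fin; toℕ; zero; suc)
open import Data.Integer as ℤ using (ℤ)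
import Data.Integer.Properties as ℤ
import Data.Integer.Tactic.RingSolver as ℤSolver
open import Data.List using (List; []; _∷_; _++_; length; lookup; drop; reverse; map; filterᵇ; upTo; applyUpTo)
open import Data.List.Membership.Propositional using (_∈_; find; lose)
open import Data.List.Membership.Propositional.Properties
open import Data.List.Properties using (unfold-reverse; length-reverse)
open import Data.List.Relation.Binary.Permutation.Propositional using (↭⇒↭ₛ; ↭-sym)
open import Data.List.Relation.Binary.Permutation.Propositional.Properties using (∈-resp-↭)
import Data.List.Relation.Binary.Permutation.Setoid.Properties as Permutation
open import Data.List.Relation.Unary.All as All using (All; []; _∷_)
import Data.List.Relation.Unary.All.Properties as All
open import Data.List.Relation.Unary.AllPairs as AllPairs using (AllPairs; []; _∷_)
import Data.List.Relation.Unary.AllPairs.Properties as AllPairs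
open import Data.List.Relation.Unary.Any using (here; there)
import Data.List.Relation.Unary.Any.Properties as Any
open import Data.List.Relation.Unary.Linked as Linked using (Linked; []; _∷_)
open import Data.List.Relation.Unary.Linked.Properties using (Linked⇒AllPairs)
open import Data.List.Relation.Unary.Unique.Propositional using (Unique)
import Data.List.Relation.Unary.Unique.Propositional.Properties as Unique
import Data.List.Sort
open import Data.Maybe using (just; nothing)
open import Data.Nat
open import Data.Nat.Properties
open import Data.Nat.Tactic.RingSolver using (solve-∀)
open import Data.Product as Product using (_×_; _,_; ∃-syntax; proj₁; proj₂)
open import Data.Sum as Sum using (_⊎_; inj₁; inj₂)
open import Data.Unit using (⊤; tt)
open import Function using (_∘_; id; Equivalence)
open import Relation.Binary using (tri<; tri≈; tri>)
open import Relation.Binary.PropositionalEquality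
open import Relation.Nullary using (¬_; Dec; yes; no; does)
open import Relation.Nullary.Decidable using (dec-true; dec-false; map′; _×-dec_; decidable-stable)

open Data.List.Sort ℤ.≤-decTotalOrder using (sort; sort-↭; sort-↗)

-- Insertion paths

module Diagram (p : ℕ → ℕ) (anti : ∀ {i k} → 1 ≤ i → i ≤ k → p k ≤ p i) where

  In : Cell → Set
  In (i , j) = 1 ≤ i × 1 ≤ j × j ≤ p i

  -- The rim, read from south-west to north-east, enters (resp. leaves) the diagonal of the cell by
  -- a north step.  North steps correspond to row ends (r , p r), so this is a condition on
  -- contents only: p r - r = j - i - 1 (resp. p r - r = j - i).  The complements "Ein" and "Eout"
  -- mean an east step.  In these terms 𝒪 = Ein ∩ Nout, 𝒜 = Ein ∩ Eout, ℬ = Nin ∩ Nout, ℐ = Nin ∩ Eout.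
  Nin Nout : Cell → Set
  Nin  (i , j) = ∃[ r ] (1 ≤ r × suc (p r + i) ≡ r + j)
  Nout (i , j) = ∃[ r ] (1 ≤ r × p r + i ≡ r + j)

  In-down : ∀ {i j k l} → 1 ≤ i → 1 ≤ j → i ≤ k → j ≤ l → In (k , l) → In (i , j)
  In-down 1≤i 1≤j i≤k j≤l (_ , _ , l≤) = 1≤i , 1≤j , ≤-trans j≤l (≤-trans l≤ (anti 1≤i i≤k))

  -- Row lengths decrease, so a row at or above that of `u` reaches at least the column of `u` and
  -- ends with content at least that of `u`, whereas the entering step needs content one less.
  Nin⇒below : ∀ {u} → In u → Nin u → ∃[ r ] (proj₁ u < r × p r + suc (proj₁ u) ≡ r + proj₂ u)
  Nin⇒below {i , j} (1≤i , 1≤j , j≤) (r , 1≤r , e) with i <? r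
  ... | yes i<r = r , i<r , trans (+-suc (p r) i) e
  ... | no i≮r = ⊥-elim (<-irrefl (sym e) (s≤s (begin
          r + j     ≤⟨ +-mono-≤ r≤i j≤pr ⟩
          i + p r   ≡⟨ +-comm i (p r) ⟩
          p r + i ∎)))
    where
    open ≤-Reasoning
    r≤i = ≮⇒≥ i≮r
    j≤pr = ≤-trans j≤ (anti 1≤r r≤i)

  Nin⇒south : ∀ {u} → In u → Nin u → In (sC u)
  Nin⇒south {i , j} inu@(1≤i , 1≤j , j≤) N with Nin⇒below inu N
  ... | r , i<r , e = s≤s z≤n , 1≤j , ≤-trans j≤pr (anti (s≤s z≤n) i<r)
    where
    open ≤-Reasoning
    j≤pr : j ≤ p r
    j≤pr = +-cancelʳ-≤ (suc i) j (p r) (begin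
      j + suc i   ≤⟨ +-monoʳ-≤ j i<r ⟩
      j + r       ≡⟨ +-comm j r ⟩
      r + j       ≡⟨ sym e ⟩
      p r + suc i ∎)

  -- If `eC (sC u)` were missing, `sC u` would end its row, and that row end is a north step
  -- entering the diagonal of `u`.
  Ein⇒southeast : ∀ {u} → ¬ Nin u → In (sC u) → In (eC (sC u))
  Ein⇒southeast {i , j} ¬N (1≤ , 1≤j , j≤) with suc j ≤? p (suc i)
  ... | yes q = 1≤ , s≤s z≤n , q
  ... | no ¬q = ⊥-elim (¬N (suc i , s≤s z≤n , cong suc
        (trans (cong (_+ i) (≤-antisym (≤-pred (≰⇒> ¬q)) j≤)) (+-comm j i))))

  Eout⇒east : ∀ {u} → In u → ¬ Nout u → In (eC u)
  Eout⇒east {i , j} (1≤i , 1≤j , j≤) ¬N with suc j ≤? p i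
  ... | yes q = 1≤i , s≤s z≤n , q
  ... | no ¬q = ⊥-elim (¬N (i , 1≤i , trans (cong (_+ i) (≤-antisym (≤-pred (≰⇒> ¬q)) j≤)) (+-comm j i)))

  foot⇒Ein : ∀ {u} → In u → ¬ In (sC u) → ¬ Nin u
  foot⇒Ein inu ¬s N = ¬s (Nin⇒south inu N)

  Nin-diagonal : ∀ {i j k l} → j + k ≡ l + i → Nin (i , j) → Nin (k , l)
  Nin-diagonal {i} {j} {k} {l} c (r , 1≤r , e) = r , 1≤r , +-cancelʳ-≡ i _ _ (begin
      suc (p r + k) + i ≡⟨ lem₁ (p r) k i ⟩
      suc (p r + i) + k ≡⟨ cong (_+ k) e ⟩
      r + j + k         ≡⟨ +-assoc r j k ⟩
      r + (j + k)       ≡⟨ cong (r +_) c ⟩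
      r + (l + i)       ≡⟨ sym (+-assoc r l i) ⟩
      r + l + i ∎)
    where
    open ≡-Reasoning
    lem₁ : ∀ x k i → suc (x + k) + i ≡ suc (x + i) + k
    lem₁ = solve-∀

  Nin-east⇒Nout : ∀ {u} → Nin (eC u) → Nout u
  Nin-east⇒Nout {i , j} (r , 1≤r , e) = r , 1≤r , suc-injective (trans e (+-suc r j))

  Nin⇒Nout-south : ∀ {u} → Nin u → Nout (sC u)
  Nin⇒Nout-south {i , j} (r , 1≤r , e) = r , 1≤r , trans (+-suc (p r) i) e

  -- The local rule and the invariants of a filling

  data Step (π : Cell → ℕ) (u : Cell) : Cell → Set where
    south : Nin u → π u ≡ π (sC u) → Step π u (sC u)
    westN : Nin u → π u ≢ π (sC u) → Step π u (wC u)
    westE : ¬ Nin u → Step π u (wC u)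

  Mono : (Cell → ℕ) → Set
  Mono π = ∀ {u} → In u → π (wC u) ≤ π u × π (nC u) ≤ π u

  -- On every diagonal only the b entries closest to the rim can be nonzero.
  Vanish : ℕ → (Cell → ℕ) → Set
  Vanish b π = ∀ {i j} → In (i , j) → In (i + b , j + b) → π (i , j) ≡ 0

  -- Read inwards from the rim, the entries of a diagonal form a partition. The condition lets the
  -- entry at `u` be raised without destroying this; on the rim itself it is vacuous.
  Addable : (Cell → ℕ) → Cell → Set
  Addable π u = In (eC (sC u)) → π u < π (eC (sC u))

  -- The content of (i , j) exceeds that of (a , b), or they are equal and i is below row ρ.
  Beyond : Cell → ℕ → Cell → Set
  Beyond (a , b) ρ (i , j) = b + i < j + a ⊎ (b + i ≡ j + a × ρ < i)

  -- On a diagonal entered by an east step, `u` and `wC u` are equally far from the rim, so the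
  -- equation compares neighbouring diagonal partitions part by part. It also prevents `u` from
  -- being a candidate. On the diagonal of the head only the rows below `ρ`, the row of the last
  -- added box, are constrained.
  Flat : Cell → ℕ → (Cell → ℕ) → Set
  Flat x ρ π = ∀ {u} → In u → ¬ Nin u → Beyond x ρ u → π u ≡ π (wC u)

  Flat-weaken : ∀ {x ρ ρ' π} → ρ ≤ ρ' → Flat x ρ π → Flat x ρ' π
  Flat-weaken le F inu ¬N (inj₁ c) = F inu ¬N (inj₁ c)
  Flat-weaken le F inu ¬N (inj₂ (c , d)) = F inu ¬N (inj₂ (c , ≤-<-trans le d))

  -- The content of (i , j) is that of (a , b) plus m.
  Ahead : Cell → ℕ → Cell → Set
  Ahead (a , b) m (i , j) = j + a ≡ b + i + m

  -- x is the head, w the tail and n the length of a rim-hook.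
  record IsHookEnds (x w : Cell) (n : ℕ) : Set where
    field
      in-x   : In x
      foot   : ¬ In (sC x)
      in-w   : In w
      rowEnd : ¬ In (eC w)
      ahead  : Ahead x n w

  record Trail (π : Cell → ℕ) (w : Cell) (q : ℕ → Cell) : Set where
    field
      start : q 0 ≡ w
      next  : ∀ t → In (q t) → Step π (q t) (q (suc t))

  -- What the next insertion uses. The fields about `q` let a path with the same head be compared
  -- with this one. Both ends of a south step are raised, so the equality that caused it still holds
  -- in `π'`, and `move` is stated there.
  record Inserted (π' : Cell → ℕ) (x w : Cell) (n : ℕ) (q : ℕ → Cell) : Set where
    field
      mono   : Mono π'
      vanish : Vanish (proj₂ x) π'
      flat   : Flat x (proj₁ (q n)) π'
      inside : ∀ {t} → t ≤ n → In (q t)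
      pos    : ∀ {t m} → t + m ≡ n → Ahead x m (q t)
      depth  : ∀ {t} → t ≤ n → ¬ In (proj₁ (q t) + proj₂ x , proj₂ (q t) + proj₂ x)
      move   : ∀ {t} → t < n →
               (Nin (q t) × π' (q t) ≡ π' (sC (q t)) × q (suc t) ≡ sC (q t)) ⊎ q (suc t) ≡ wC (q t)

  OnTrail : (ℕ → Cell) → ℕ → Cell → Set
  OnTrail q n u = ∃[ t ] (t ≤ n × q t ≡ u)

  record Adds (π : Cell → ℕ) (q : ℕ → Cell) (n : ℕ) (π' : Cell → ℕ) : Set where
    field
      on? : ∀ u → Dec (OnTrail q n u)
      on  : ∀ {t} → t ≤ n → π' (q t) ≡ suc (π (q t))
      off : ∀ {u} → ¬ OnTrail q n u → π' u ≡ π u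

  record Outcome (π π' : Cell → ℕ) (x w : Cell) (n : ℕ) (q : ℕ → Cell) : Set where
    field
      inserted         : Inserted π' x w n q
      compatible-east  : ∀ {u} → OnTrail q n u → ¬ Nout u → OnTrail q n (eC u) × π u ≡ π (eC u)
      compatible-south : ∀ {u} → OnTrail q n u → OnTrail q n (sC u) → π u ≡ π (sC u)
      end-Ein          : ¬ Nin (q n)
      end>west         : π' (wC (q n)) < π' (q n)
      end>north        : ¬ Nout (q n) → π' (nC (q n)) < π' (q n)

  same-diagonal : ∀ {x m u v} → Ahead x m u → Ahead x m v → proj₂ u + proj₁ v ≡ proj₂ v + proj₁ u
  same-diagonal {a , b} {m} {i , j} {k , l} e f = +-cancelʳ-≡ (a + m + b) _ _ (begin
      j + k + (a + m + b)   ≡⟨ lem j k a m b ⟩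
      (j + a) + (b + k + m) ≡⟨ cong₂ _+_ e (sym f) ⟩
      (b + i + m) + (l + a) ≡⟨ lem' b i m l a ⟩
      l + i + (a + m + b) ∎)
    where
    open ≡-Reasoning
    lem : ∀ j k a m b → j + k + (a + m + b) ≡ (j + a) + (b + k + m)
    lem = solve-∀
    lem' : ∀ b i m l a → (b + i + m) + (l + a) ≡ l + i + (a + m + b)
    lem' = solve-∀

  -- Guard and safe abstract the reason why a path never leaves the diagram to the west.
  module Walk {π x w n q} (ends : IsHookEnds x w n) (trail : Trail π w q)
    (mono : Mono π) (flat : ∀ {u} → In u → ¬ Nin u → proj₂ x + proj₁ u < proj₂ u + proj₁ x → π u ≡ π (wC u))
    (Guard : ℕ → Cell → Set)
    (guard₀ : Guard 0 w)
    (guard⁺ : ∀ {t m u v} → t + suc m ≡ n → In u → Ahead x (suc m) u → Step π u v → Guard t u → Guard (suc t) v)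
    (safe : ∀ {t m u} → t + m ≡ n → Ahead x m u → Addable π u → Guard t u →
              1 ≤ proj₂ u × ¬ In (proj₁ u + proj₂ x , proj₂ u + proj₂ x))
    where
    open IsHookEnds ends
    open Trail trail

    Good : ℕ → ℕ → Cell → Set
    Good t m u = In u × Ahead x m u × Addable π u × Guard t u

    ahead⇒> : ∀ {m} u → Ahead x (suc m) u → proj₂ x + proj₁ u < proj₂ u + proj₁ x
    ahead⇒> {m} u c = subst (proj₂ x + proj₁ u <_) (sym c) (m<m+n _ (s≤s z≤n))

    good₀ : Good 0 n w
    good₀ = in-w , ahead , (λ se → ⊥-elim (rowEnd (In-down (proj₁ in-w) (s≤s z≤n) (n≤1+n _) ≤-refl se))) , guard₀

    -- Addability survives a south step since `π u` equals `π (sC u)` and columns weakly increase.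
    -- It survives a west step from a north-entered diagonal since `sC u` is diagonally south-east
    -- of `wC u` and its entry exceeds that of `u`. From an east-entered diagonal, flatness moves
    -- both sides of the inequality for `u` one cell to the west.
    good⁺ : ∀ {t m u v} → t + suc m ≡ n → Step π u v → Good t (suc m) u → Good (suc t) m v
    good⁺ {t} {m} {i , j} e st@(south N eq) (inu , c , add , g) =
      inv , c' , add' , guard⁺ e inu c st g
      where
      inv = Nin⇒south inu N
      c' : Ahead x m (suc i , j)
      c' = trans c (lem (proj₂ x) i m)
        where
        lem : ∀ b i m → b + i + suc m ≡ b + suc i + m
        lem = solve-∀
      add' : Addable π (suc i , j)
      add' se = subst (_< π (suc (suc i) , suc j)) eq
        (<-≤-trans (add (In-down (s≤s z≤n) (s≤s z≤n) (n≤1+n _) ≤-refl se)) (proj₂ (mono se)))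
    good⁺ {t} {m} {i , suc j} e st@(westN N neq) (inu , c , add , g) =
      -- `safe` does not presuppose that the new cell lies in the diagram; it is what rules out
      -- column 0.
      (proj₁ inu , proj₁ (safe e' c' add' g') , ≤-trans (n≤1+n j) (proj₂ (proj₂ inu))) , c' , add' , g'
      where
      e' = trans (sym (+-suc t m)) e
      g' = guard⁺ e inu c st g
      c' : Ahead x m (i , j)
      c' = suc-injective (trans c (+-suc (proj₂ x + i) m))
      add' : Addable π (i , j)
      add' se = ≤-<-trans (proj₁ (mono inu)) (≤∧≢⇒< (proj₂ (mono se)) neq)
    good⁺ {t} {m} {i , suc j} e st@(westE E) (inu , c , add , g) =
      (proj₁ inu , proj₁ (safe e' c' add' g') , ≤-trans (n≤1+n j) (proj₂ (proj₂ inu))) , c' , add' , g'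
      where
      e' = trans (sym (+-suc t m)) e
      g' = guard⁺ e inu c st g
      c' : Ahead x m (i , j)
      c' = suc-injective (trans c (+-suc (proj₂ x + i) m))
      add' : Addable π (i , j)
      add' s = subst₂ _<_ (flat inu E (ahead⇒> _ c))
                 (flat se (λ N → E (Nin-diagonal (lem j i) N))
                   (subst (_< suc (suc j) + proj₁ x) (sym (+-suc (proj₂ x) i)) (s≤s (ahead⇒> (i , suc j) c))))
                 (add se)
        where
        se = Ein⇒southeast E s
        lem : ∀ j i → suc (suc j) + i ≡ suc j + suc i
        lem = solve-∀
    good⁺ {u = i , zero} e (westN _ _) ((_ , () , _) , _)
    good⁺ {u = i , zero} e (westE _) ((_ , () , _) , _)

    good : ∀ t {m} → t + m ≡ n → Good t m (q t)
    good zero refl = subst (Good 0 n) (sym start) good₀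
    good (suc t) {m} e = good⁺ e' (next t (proj₁ g)) g
      where
      e' = trans (+-suc t m) e
      g = good t e'

    good-≤ : ∀ {t} → t ≤ n → Good t (n ∸ t) (q t)
    good-≤ {t} t≤n = good t (m+[n∸m]≡n t≤n)

    good-end : Good n 0 (q n)
    good-end = good n (+-identityʳ n)

    ahead-before : ∀ {t} → t < n → Ahead x (suc (n ∸ suc t)) (q t)
    ahead-before {t} t<n = proj₁ (proj₂ (good t (trans (+-suc t _) (m+[n∸m]≡n t<n))))

    at-end : proj₂ (q n) + proj₁ x ≡ proj₂ x + proj₁ (q n)
    at-end = trans (proj₁ (proj₂ good-end)) (+-identityʳ _)

    -- The last cell shares its diagonal with the head, and the head is the foot of its column.
    end-Ein : ¬ Nin (q n)
    end-Ein N = foot⇒Ein in-x foot (Nin-diagonal (same-diagonal {x} {0} {q n} {x} (proj₁ (proj₂ good-end)) at-x) N)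
      where
      at-x : Ahead x 0 x
      at-x = sym (+-identityʳ _)

    module Insert (vanish : Vanish (proj₂ x) π) (flat≥ : Flat x (proj₁ (q n)) π)
      {π' : Cell → ℕ} (adds : Adds π q n π')
      where
      open Adds adds

      On : Cell → Set
      On = OnTrail q n

      on-suc : ∀ {u} → On u → π' u ≡ suc (π u)
      on-suc (t , t≤n , refl) = on t≤n

      on-In : ∀ {u} → On u → In u
      on-In (t , t≤n , refl) = proj₁ (good-≤ t≤n)

      π≤π' : ∀ u → π u ≤ π' u
      π≤π' u with on? u
      ... | yes o = subst (π u ≤_) (sym (on-suc o)) (n≤1+n _)
      ... | no ¬o = ≤-reflexive (sym (off ¬o))

      stepAt : ∀ {t} → t ≤ n → Step π (q t) (q (suc t))
      stepAt {t} t≤n = next t (proj₁ (good-≤ t≤n))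

      on-ahead : ∀ {u m} → On u → Ahead x m u → ∃[ t ] (t + m ≡ n × q t ≡ u)
      on-ahead {u} {m} (t , t≤n , refl) c = t , trans (cong (t +_) m≡) (m+[n∸m]≡n t≤n) , refl
        where
        m≡ : m ≡ n ∸ t
        m≡ = +-cancelˡ-≡ (proj₂ x + proj₁ (q t)) _ _ (trans (sym c) (proj₁ (proj₂ (good-≤ t≤n))))

      on-≥ : ∀ {u} → On u → proj₂ x + proj₁ u ≤ proj₂ u + proj₁ x
      on-≥ (t , t≤n , refl) = subst (proj₂ x + proj₁ (q t) ≤_) (sym (proj₁ (proj₂ (good-≤ t≤n)))) (m≤m+n _ _)

      >⇒ahead : ∀ {u} → proj₂ x + proj₁ u < proj₂ u + proj₁ x → ∃[ m ] Ahead x (suc m) u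
      >⇒ahead {u} lt = proj₂ u + proj₁ x ∸ suc (proj₂ x + proj₁ u) ,
        sym (trans (+-suc _ _) (m+[n∸m]≡n lt))

      on->⇒< : ∀ {u} → On u → proj₂ x + proj₁ u < proj₂ u + proj₁ x → ∃[ t ] (t < n × q t ≡ u)
      on->⇒< o lt with >⇒ahead lt
      ... | m , c with on-ahead o c
      ... | t , e , eq = t , subst (suc t ≤_) (trans (sym (+-suc t m)) e) (s≤s (m≤m+n t m)) , eq

      north-on : ∀ {u} → In u → On (nC u) → ∃[ t ] (t ≤ n × sC (q t) ≡ u)
      north-on {suc i , j} _ (t , t≤n , eq) = t , t≤n , cong sC eq

      -- The trail reaches `wC u` from `u`, or by a south step from the cell above, which is then
      -- diagonally north-west of `u`. It cannot start at `wC u`, because the tail ends its row.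
      west-on : ∀ {u} → In u → On (wC u) → On u ⊎
                ∃[ t ] (t < n × Nin (q t) × π (q t) ≡ π (wC u) × eC (sC (q t)) ≡ u)
      west-on {i , suc j} inu (zero , _ , eq) = ⊥-elim (rowEnd (subst (λ v → In (eC v)) (trans (sym eq) start) inu))
      west-on {i , suc j} inu (suc t , t<n , eq) = go (stepAt (<⇒≤ t<n)) eq
        where
        in-t = proj₁ (good-≤ (<⇒≤ t<n))
        shift : ∀ {u} → In u → wC u ≡ (i , j) → u ≡ (i , suc j)
        shift {_ , suc _} _ refl = refl
        shift {_ , zero} (_ , () , _) _
        go : ∀ {v} → Step π (q t) v → v ≡ (i , j) → On (i , suc j) ⊎
             ∃[ t ] (t < n × Nin (q t) × π (q t) ≡ π (i , j) × eC (sC (q t)) ≡ (i , suc j))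
        go (south N e) eq = inj₂ (t , t<n , N , trans e (cong π eq) , cong eC eq)
        go (westN _ _) eq = inj₁ (t , <⇒≤ t<n , shift in-t eq)
        go (westE _) eq = inj₁ (t , <⇒≤ t<n , shift in-t eq)

      diagonal-Nin : ∀ {u} → Nin u → Nin (eC (sC u))
      diagonal-Nin {i , j} = Nin-diagonal (+-suc j i)

      Nin-diagonal⁻ : ∀ {u} → Nin (eC (sC u)) → Nin u
      Nin-diagonal⁻ {i , j} = Nin-diagonal (sym (+-suc j i))

      west : ∀ {u v} → Step π u v → ¬ Nin u → v ≡ wC u
      west (south N _) ¬N = ⊥-elim (¬N N)
      west (westN N _) ¬N = ⊥-elim (¬N N)
      west (westE _) ¬N = refl

      off-left : ∀ {u} → In u → proj₂ x + proj₁ u ≡ proj₂ u + proj₁ x → ¬ On (wC u)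
      off-left {i , suc j} inu c o = <-irrefl c (s≤s (on-≥ o))
      off-left {i , zero} (_ , () , _)

      -- Only a raised cell next to an unraised one is at risk. If `wC u` alone is raised, the trail
      -- came down to it from the cell north-west of `u`, and addability there gives the room. If
      -- `nC u` alone is raised, the trail turned west or ended there: either the two entries
      -- differed, or addability combines with flatness.
      mono' : Mono π'
      mono' {u} inu = fromWest , fromNorth
        where
        fromWest : π' (wC u) ≤ π' u
        fromWest with on? (wC u)
        ... | no ¬o = ≤-trans (≤-reflexive (off ¬o)) (≤-trans (proj₁ (mono inu)) (π≤π' u))
        ... | yes o with west-on inu o
        ... | inj₁ o' = subst₂ _≤_ (sym (on-suc o)) (sym (on-suc o')) (s≤s (proj₁ (mono inu)))
        ... | inj₂ (t , t<n , N , e , refl) = ≤-trans (≤-reflexive (on-suc o)) (≤-trans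
                (subst (_< π u) e (proj₁ (proj₂ (proj₂ (good-≤ (<⇒≤ t<n)))) inu)) (π≤π' u))
        strict : ∀ t → t ≤ n → sC (q t) ≡ u → ¬ On u → ¬ Nin (q t) → π (q t) < π u
        strict t t≤n refl ¬o ¬N = subst (π (q t) <_)
            (flat≥ se (λ N → ¬N (Nin-diagonal⁻ {q t} N)) beyond)
            (proj₁ (proj₂ (proj₂ (good-≤ t≤n))) se)
          where
          se = Ein⇒southeast ¬N inu
          beyond : Beyond x (proj₁ (q n)) (eC (sC (q t)))
          beyond with m≤n⇒m<n∨m≡n t≤n
          ... | inj₁ t<n = inj₁ (subst (_< suc (proj₂ (q t) + proj₁ x)) (sym (+-suc (proj₂ x) _))
                  (s≤s (ahead⇒> {m = n ∸ suc t} (q t) (ahead-before t<n))))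
          -- The last cell lies on the diagonal of the head and its south-east neighbour one row
          -- further down, so the row clause of `Beyond` applies.
          ... | inj₂ refl = inj₂ (trans (+-suc (proj₂ x) _) (cong suc (sym at-end)) , ≤-refl)
        fromNorth : π' (nC u) ≤ π' u
        fromNorth with on? (nC u) | on? u
        ... | no ¬o | _ = ≤-trans (≤-reflexive (off ¬o)) (≤-trans (proj₂ (mono inu)) (π≤π' u))
        ... | yes o | yes o' = subst₂ _≤_ (sym (on-suc o)) (sym (on-suc o')) (s≤s (proj₂ (mono inu)))
        ... | yes o | no ¬o with north-on inu o
        ... | t , t≤n , refl = subst₂ _≤_ (sym (on t≤n)) (sym (off ¬o)) bound
          where
          bound : suc (π (q t)) ≤ π (sC (q t))
          bound with m≤n⇒m<n∨m≡n t≤n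
          ... | inj₂ refl = strict t t≤n refl ¬o end-Ein
          ... | inj₁ t<n = go (stepAt t≤n) refl
            where
            go : ∀ {v} → Step π (q t) v → q (suc t) ≡ v → suc (π (q t)) ≤ π (sC (q t))
            go (south N e) eq = ⊥-elim (¬o (suc t , t<n , eq))
            go (westN N e) eq = ≤∧≢⇒< (proj₂ (mono inu)) e
            go (westE ¬N) eq = strict t t≤n refl ¬o ¬N

      -- The trail leaves an east-entered diagonal only by a west step, so beyond the head it raises
      -- `u` and `wC u` together. On the diagonal of the head it raises only its last cell, which
      -- the row bound excludes, and `wC u` has too small a content to be on the trail.
      flat' : Flat x (proj₁ (q n)) π'
      flat' {u} inu ¬N bey@(inj₁ c) with on? u | on? (wC u)
      ... | yes o | yes o' = trans (on-suc o) (trans (cong suc (flat≥ inu ¬N bey)) (sym (on-suc o')))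
      ... | no ¬o | no ¬o' = trans (off ¬o) (trans (flat≥ inu ¬N bey) (sym (off ¬o')))
      ... | yes o | no ¬o' with on->⇒< o c
      ... | t , t<n , refl = ⊥-elim (¬o' (suc t , t<n , west (stepAt (<⇒≤ t<n)) ¬N))
      flat' {u} inu ¬N bey@(inj₁ c) | no ¬o | yes o' with west-on inu o'
      ... | inj₁ o = ⊥-elim (¬o o)
      ... | inj₂ (t , t<n , N , _ , refl) = ⊥-elim (¬N (diagonal-Nin {q t} N))
      flat' {u} inu ¬N bey@(inj₂ (c , ρ<)) =
        trans (off ¬o) (trans (flat≥ inu ¬N bey) (sym (off (off-left inu c))))
        where
        ¬o : ¬ On u
        ¬o o with on-ahead {m = 0} o (trans (sym c) (sym (+-identityʳ _)))
        ... | t , e , refl with trans (sym (+-identityʳ t)) e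
        ... | refl = <-irrefl refl ρ<

      inserted : Inserted π' x w n q
      inserted = record
        { mono   = mono'
        ; vanish = λ {i} {j} inu deep → trans (off (λ { (t , t≤n , refl) → depth t≤n deep })) (vanish inu deep)
        ; flat   = flat'
        ; inside = λ t≤n → proj₁ (good-≤ t≤n)
        ; pos    = λ {t} e → proj₁ (proj₂ (good t e))
        ; depth  = depth
        ; move   = λ {t} t<n → go t t<n (stepAt (<⇒≤ t<n)) refl
        }
        where
        depth : ∀ {t} → t ≤ n → ¬ In (proj₁ (q t) + proj₂ x , proj₂ (q t) + proj₂ x)
        depth {t} t≤n with good-≤ t≤n
        ... | _ , c , add , g = proj₂ (safe (m+[n∸m]≡n t≤n) c add g)
        go : ∀ t → t < n → ∀ {v} → Step π (q t) v → q (suc t) ≡ v →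
             (Nin (q t) × π' (q t) ≡ π' (sC (q t)) × q (suc t) ≡ sC (q t)) ⊎ q (suc t) ≡ wC (q t)
        go t t<n (south N e) eq = inj₁ (N , trans (on (<⇒≤ t<n)) (trans (cong suc e) (sym (on-suc (suc t , t<n , eq)))) , eq)
        go t t<n (westN _ _) eq = inj₂ eq
        go t t<n (westE _) eq = inj₂ eq

      -- Had the trail come to `u` from above, the rim would leave the diagonal of `u` by a north
      -- step. So it came from `eC u`, and flatness makes the entries equal.
      compatible-east : ∀ {u} → On u → ¬ Nout u → On (eC u) × π u ≡ π (eC u)
      compatible-east {u} o ¬N with west-on (Eout⇒east (on-In o) ¬N) o
      ... | inj₂ (t , _ , N , _ , refl) = ⊥-elim (¬N (Nin⇒Nout-south {q t} N))
      ... | inj₁ o' = o' , sym (flat≥ (Eout⇒east (on-In o) ¬N) (λ N → ¬N (Nin-east⇒Nout {u} N))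
                             (inj₁ (s≤s (on-≥ o))))

      -- The content falls by one per step, so each diagonal carries at most one trail cell. Hence
      -- `sC u` is the immediate successor of `u`, and only a south step leads there.
      on-step : ∀ {u} → On u → On (sC u) → Nin u × π u ≡ π (sC u)
      on-step {u} o o' with on->⇒< o (≤-trans (≤-reflexive (sym (+-suc (proj₂ x) (proj₁ u)))) (on-≥ o'))
      ... | t , t<n , refl = go (stepAt (<⇒≤ t<n)) refl
        where
        go : ∀ {v} → Step π (q t) v → q (suc t) ≡ v → Nin (q t) × π (q t) ≡ π (sC (q t))
        go-west : q (suc t) ≡ wC (q t) → ⊥
        go-west eq with on-ahead {m = n ∸ suc t} o' c
          where
          c : Ahead x (n ∸ suc t) (sC (q t))
          c = trans (ahead-before t<n) (trans (+-suc _ _) (cong (_+ (n ∸ suc t)) (sym (+-suc (proj₂ x) _))))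
        ... | t' , e , eq' with +-cancelʳ-≡ (n ∸ suc t) t' (suc t) (trans e (sym (m+[n∸m]≡n t<n)))
        ... | refl = 1+n≢n (cong proj₁ (trans (sym eq') eq))
        go (south N e) eq = N , e
        go (westN _ _) eq = ⊥-elim (go-west eq)
        go (westE _) eq = ⊥-elim (go-west eq)

      compatible-south : ∀ {u} → On u → On (sC u) → π u ≡ π (sC u)
      compatible-south o o' = proj₂ (on-step o o')

      end-on : On (q n)
      end-on = n , ≤-refl , refl

      end>west : π' (wC (q n)) < π' (q n)
      end>west = subst₂ _<_ (sym (off (off-left in-end (sym at-end))))
                   (sym (on-suc end-on)) (s≤s (proj₁ (mono in-end)))
        where in-end = proj₁ good-end

      -- Were the cell above raised, the trail would have come down from it, and the rim would leave
      -- the diagonal of the last cell by a north step.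
      end>north : ¬ Nout (q n) → π' (nC (q n)) < π' (q n)
      end>north ¬N = subst₂ _<_ (sym (off ¬o)) (sym (on-suc end-on)) (s≤s (proj₂ (mono (proj₁ good-end))))
        where
        ¬o : ¬ On (nC (q n))
        ¬o o with north-on (proj₁ good-end) o
        ... | t , t≤n , eq = ¬N (subst Nout eq (Nin⇒Nout-south {q t}
                (proj₁ (on-step (t , t≤n , refl) (n , ≤-refl , sym eq)))))

      outcome : Outcome π π' x w n q
      outcome = record
        { inserted = inserted
        ; compatible-east = compatible-east ; compatible-south = compatible-south
        ; end-Ein = end-Ein ; end>west = end>west ; end>north = end>north }

  -- Only the outermost `b` entries of a diagonal can be nonzero, so an addable cell is among the
  -- outermost `b + 1`. As the head lies in a column past `b`, this is the depth allowed.
  insert-fresh : ∀ {π π' x w n q b} → IsHookEnds x w n → Trail π w q → Adds π q n π' →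
                 Mono π → b < proj₂ x → Vanish b π → Flat x 0 π → Outcome π π' x w n q
  insert-fresh {π} {π'} {x} {w} {n} {q} {b} ends trail adds mono b<x vanish flat =
    W.Insert.outcome vanish' (Flat-weaken z≤n flat) adds
    where
    open IsHookEnds ends
    1≤x = proj₁ (proj₂ in-x)
    vanish' : Vanish (proj₂ x) π
    vanish' {i} {j} inu@(1≤i , 1≤j , _) deep = vanish inu
      (In-down (≤-trans 1≤i (m≤m+n i b)) (≤-trans 1≤j (m≤m+n j b))
               (+-monoʳ-≤ i (<⇒≤ b<x)) (+-monoʳ-≤ j (<⇒≤ b<x)) deep)
    shallow : ∀ {u} → Addable π u → ¬ In (proj₁ u + proj₂ x , proj₂ u + proj₂ x)
    shallow {i , j} add deep = n≮0 (subst (π (i , j) <_) (vanish se deep') (add se))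
      where
      shift : ∀ k → suc k ≤ k + proj₂ x
      shift k = subst (_≤ k + proj₂ x) (+-comm k 1) (+-monoʳ-≤ k 1≤x)
      shift' : ∀ k → suc k + b ≤ k + proj₂ x
      shift' k = subst (_≤ k + proj₂ x) (+-suc k b) (+-monoʳ-≤ k b<x)
      se : In (suc i , suc j)
      se = In-down (s≤s z≤n) (s≤s z≤n) (shift i) (shift j) deep
      deep' : In (suc i + b , suc j + b)
      deep' = In-down (s≤s z≤n) (s≤s z≤n) (shift' i) (shift' j) deep
    safe : ∀ {t m u} → t + m ≡ n → Ahead x m u → Addable π u → ⊤ →
           1 ≤ proj₂ u × ¬ In (proj₁ u + proj₂ x , proj₂ u + proj₂ x)
    safe {u = i , suc j} _ _ add _ = s≤s z≤n , shallow add
    -- A cell in column 0 whose content is at least that of the head would be too deep: moved by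
    -- `proj₂ x` along its diagonal it reaches the column of `x`, in a row not below `x`, hence
    -- inside the diagram.
    safe {m = m} {u = i , zero} _ c add _ = ⊥-elim (shallow add
      (≤-trans 1≤x (m≤n+m _ i) , 1≤x ,
       ≤-trans (proj₂ (proj₂ in-x)) (anti (≤-trans 1≤x (m≤n+m _ i))
         (subst (_≤ proj₁ x) (+-comm (proj₂ x) i) (subst (proj₂ x + i ≤_) (sym c) (m≤m+n _ m))))))
    module W = Walk ends trail mono (λ inu ¬N c → flat inu ¬N (inj₁ c)) 
      (λ _ _ → ⊤) tt (λ _ _ _ _ _ → tt) (λ {t} {m} {u} → safe {t} {m} {u})

  -- Both paths end on the diagonal of the head, so after skipping the first `d` cells of the old
  -- one, cells of equal index share a diagonal. Staying south-east of the old path bounds the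
  -- column and the depth of the new one, and comparing the last cells turns flatness below the old
  -- end into flatness below the new end.
  insert-again : ∀ {π π' x w w' n n' q q'} → IsHookEnds x w n → Trail π w q → Adds π q n π' →
                 IsHookEnds x w' n' → Inserted π x w' n' q' → proj₁ w' ≤ proj₁ w → Outcome π π' x w n q
  insert-again {π} {π'} {x} {w} {w'} {n} {n'} {q} {q'} ends trail adds ends' ins w'≤w =
    W.Insert.outcome I.vanish (Flat-weaken last≤ I.flat) adds
    where
    open IsHookEnds ends
    module I = Inserted ins
    module E' = IsHookEnds ends'

    cols : proj₂ w ≤ proj₂ w'
    cols = ≮⇒≥ λ lt → E'.rowEnd (In-down (proj₁ E'.in-w) (s≤s z≤n) w'≤w lt in-w)

    n≤n' : n ≤ n'
    n≤n' = +-cancelˡ-≤ (proj₂ x + proj₁ w) n n' (begin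
      proj₂ x + proj₁ w + n   ≡⟨ sym ahead ⟩
      proj₂ w + proj₁ x       ≤⟨ +-monoˡ-≤ (proj₁ x) cols ⟩
      proj₂ w' + proj₁ x      ≡⟨ E'.ahead ⟩
      proj₂ x + proj₁ w' + n' ≤⟨ +-monoˡ-≤ n' (+-monoʳ-≤ (proj₂ x) w'≤w) ⟩
      proj₂ x + proj₁ w + n'  ∎)
      where open ≤-Reasoning

    d = n' ∸ n

    shifted : ∀ {t m} → t + m ≡ n → d + t + m ≡ n'
    shifted {t} {m} e = trans (+-assoc d t m) (trans (cong (d +_) e) (m∸n+n≡m n≤n'))

    -- The new path stays weakly south-east of the old one: where they meet and the old one turned
    -- south, both entries were raised, so they are still equal and the new path turns south too.
    Guard : ℕ → Cell → Set
    Guard t u = proj₁ (q' (d + t)) ≤ proj₁ u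

    cols-≤ : ∀ {t m u} → t + m ≡ n → Ahead x m u → Guard t u → proj₂ (q' (d + t)) ≤ proj₂ u
    cols-≤ {t} {m} {u} e c g = +-cancelʳ-≤ (proj₁ u) _ _ (begin
      proj₂ (q' (d + t)) + proj₁ u ≡⟨ same-diagonal {x} {m} {q' (d + t)} {u} (I.pos (shifted e)) c ⟩
      proj₂ u + proj₁ (q' (d + t)) ≤⟨ +-monoʳ-≤ (proj₂ u) g ⟩
      proj₂ u + proj₁ u ∎)
      where open ≤-Reasoning

    inside' : ∀ {t m} → t + m ≡ n → In (q' (d + t))
    inside' {t} {m} e = I.inside (subst (d + t ≤_) (shifted e) (m≤m+n (d + t) m))

    guard₀ : Guard 0 w
    -- An old cell further down the diagonal of `w` would also lie in a later column, which puts
    -- `eC w` in the diagram.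
    guard₀ = ≮⇒≥ λ lt → rowEnd (In-down (proj₁ in-w) (s≤s z≤n) (<⇒≤ lt) (col< lt) (inside' refl))
      where
      open ≤-Reasoning
      col< : proj₁ w < proj₁ (q' (d + 0)) → proj₂ w < proj₂ (q' (d + 0))
      col< lt = +-cancelʳ-< (proj₁ w) _ _ (begin-strict
        proj₂ w + proj₁ w            <⟨ +-monoʳ-< (proj₂ w) lt ⟩
        proj₂ w + proj₁ (q' (d + 0)) ≡⟨ same-diagonal {x} {n} {w} {q' (d + 0)} ahead (I.pos (shifted refl)) ⟩
        proj₂ (q' (d + 0)) + proj₁ w ∎)

    row-mono : ∀ {u v} → Step π u v → proj₁ u ≤ proj₁ v
    row-mono (south _ _) = n≤1+n _
    row-mono (westN _ _) = ≤-refl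
    row-mono (westE _) = ≤-refl

    guard⁺ : ∀ {t m u v} → t + suc m ≡ n → In u → Ahead x (suc m) u → Step π u v → Guard t u → Guard (suc t) v
    guard⁺ {t} {m} {u} {v} e inu c st g = subst (λ z → proj₁ (q' z) ≤ proj₁ v) (sym (+-suc d t))
      (go (I.move (subst (suc (d + t) ≤_) (trans (sym (+-suc (d + t) m)) (shifted e)) (s≤s (m≤m+n (d + t) m)))))
      where
      go : (Nin (q' (d + t)) × π (q' (d + t)) ≡ π (sC (q' (d + t))) × q' (suc (d + t)) ≡ sC (q' (d + t)))
           ⊎ q' (suc (d + t)) ≡ wC (q' (d + t)) → proj₁ (q' (suc (d + t))) ≤ proj₁ v
      go (inj₂ eq) = subst (_≤ proj₁ v) (sym (cong proj₁ eq)) (≤-trans g (row-mono st))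
      go (inj₁ (N , same , eq)) with m≤n⇒m<n∨m≡n g
      ... | inj₁ lt = subst (_≤ proj₁ v) (sym (cong proj₁ eq)) (≤-trans lt (row-mono st))
      ... | inj₂ rows = subst (_≤ proj₁ v) (sym (trans (cong proj₁ eq) (cong suc rows))) (forced st)
        where
        u≡ : q' (d + t) ≡ u
        u≡ = cong₂ _,_ rows (+-cancelʳ-≡ (proj₁ u) _ _ (trans
               (same-diagonal {x} {suc m} {q' (d + t)} {u} (I.pos (shifted e)) c) (cong (proj₂ u +_) rows)))
        forced : ∀ {v} → Step π u v → suc (proj₁ u) ≤ proj₁ v
        forced (south _ _) = ≤-refl
        forced (westN _ ne) = ⊥-elim (ne (subst (λ z → π z ≡ π (sC z)) u≡ same))
        forced (westE ¬N) = ⊥-elim (¬N (subst Nin u≡ N))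

    safe : ∀ {t m u} → t + m ≡ n → Ahead x m u → Addable π u → Guard t u →
           1 ≤ proj₂ u × ¬ In (proj₁ u + proj₂ x , proj₂ u + proj₂ x)
    safe {t} {m} {u} e c _ g = ≤-trans (proj₁ (proj₂ in')) le ,
      λ deep → I.depth (subst (d + t ≤_) (shifted e) (m≤m+n (d + t) m))
        (In-down (≤-trans (proj₁ in') (m≤m+n _ _)) (≤-trans (proj₁ (proj₂ in')) (m≤m+n _ _))
                 (+-monoˡ-≤ (proj₂ x) g) (+-monoˡ-≤ (proj₂ x) le) deep)
      where
      in' = inside' e
      le = cols-≤ {u = u} e c g

    module W = Walk ends trail I.mono (λ inu ¬N c → I.flat inu ¬N (inj₁ c))
      Guard guard₀ guard⁺ (λ {t} {m} {u} → safe {t} {m} {u})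

    last≤ : proj₁ (q' n') ≤ proj₁ (q n)
    last≤ = subst (λ z → proj₁ (q' z) ≤ proj₁ (q n)) (m∸n+n≡m n≤n') (proj₂ (proj₂ (proj₂ W.good-end)))

  -- The old head is the foot of its column, so a head further east is in no lower row and has
  -- greater content. Its whole diagonal is thus strictly beyond the old head, and no row bound
  -- remains.
  Flat-advance : ∀ {π x x' ρ} → In x → In x' → ¬ In (sC x') → proj₂ x' < proj₂ x → Flat x' ρ π → Flat x 0 π
  Flat-advance {x = a , b} {a' , b'} in-x in-x' foot' b'<b F {i , j} inu ¬N bey = F inu ¬N (inj₁ (begin-strict
      b' + i <⟨ +-monoˡ-< i b'<b ⟩
      b + i  ≤⟨ weak bey ⟩
      j + a  ≤⟨ +-monoʳ-≤ j a≤a' ⟩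
      j + a' ∎))
    where
    open ≤-Reasoning
    a≤a' : a ≤ a'
    a≤a' = ≮⇒≥ λ lt → foot' (In-down (s≤s z≤n) (proj₁ (proj₂ in-x')) lt (<⇒≤ b'<b) in-x)
    weak : Beyond (a , b) 0 (i , j) → b + i ≤ j + a
    weak (inj₁ lt) = <⇒≤ lt
    weak (inj₂ (e , _)) = ≤-reflexive e

-- The sets 𝒜 and ℬ along the rim

anyBelow : (ℕ → Bool) → ℕ → Bool
anyBelow f zero    = false
anyBelow f (suc n) = f 0 ∨ anyBelow (f ∘ suc) n

any-applyUpTo : ∀ (f : ℕ → Bool) (g : ℕ → ℕ) n → any f (applyUpTo g n) ≡ anyBelow (f ∘ g) n
any-applyUpTo f g zero    = refl
any-applyUpTo f g (suc n) = cong (f (g 0) ∨_) (any-applyUpTo f (g ∘ suc) n)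

anyBelow-false : ∀ f n → (∀ k → f k ≡ false) → anyBelow f n ≡ false
anyBelow-false f zero    _ = refl
anyBelow-false f (suc n) z rewrite z 0 = anyBelow-false (f ∘ suc) n (z ∘ suc)

-- Membership in 𝒜 and ℬ read off the interlacing corner contents.  The index E or N
-- tells by which kind of step the rim enters the first diagonal still to be scanned.
𝒜ᴱ 𝒜ᴺ ℬᴱ ℬᴺ : List ℤ → List ℤ → ℤ → Bool
𝒜ᴱ []       is c = false
𝒜ᴱ (o ∷ os) is c = (c <ᶻ o) ∨ 𝒜ᴺ os is c
𝒜ᴺ os       []       c = false
𝒜ᴺ []       (i ∷ is) c = false
𝒜ᴺ (o ∷ os) (i ∷ is) c = ((i <ᶻ c) ∧ (c <ᶻ o)) ∨ 𝒜ᴺ os is c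
ℬᴱ []       is       c = false
ℬᴱ (o ∷ os) []       c = o <ᶻ c
ℬᴱ (o ∷ os) (i ∷ is) c = ((o <ᶻ c) ∧ (c <ᶻ i)) ∨ ℬᴱ os is c
ℬᴺ os []       c = true
ℬᴺ os (i ∷ is) c = (c <ᶻ i) ∨ ℬᴱ os is c

between-nothing : ∀ x c → between x nothing c ≡ false
between-nothing (just _) c = refl
between-nothing nothing  c = refl

indexed-𝒜ᴺ : ∀ os is c → anyBelow (λ k → between (nth is k) (nth os k) c) (length is) ≡ 𝒜ᴺ os is c
indexed-𝒜ᴺ os       []       c = refl
indexed-𝒜ᴺ []       (i ∷ is) c =
  anyBelow-false (λ k → between (nth is k) nothing c) (length is) (λ k → between-nothing (nth is k) c)
indexed-𝒜ᴺ (o ∷ os) (i ∷ is) c = cong (((i <ᶻ c) ∧ (c <ᶻ o)) ∨_) (indexed-𝒜ᴺ os is c)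

indexed-𝒜 : ∀ os is c →
  (below c (nth os 0) ∨ any (λ k → between (nth is k) (nth os (suc k)) c) (upTo (length is))) ≡ 𝒜ᴱ os is c
indexed-𝒜 [] is c =
  trans (any-applyUpTo _ id (length is))
        (anyBelow-false _ (length is) (λ k → between-nothing (nth is k) c))
indexed-𝒜 (o ∷ os) is c = cong ((c <ᶻ o) ∨_) (trans (any-applyUpTo _ id (length is)) (indexed-𝒜ᴺ os is c))

indexed-ℬ : ∀ os is c →
  (any (λ k → between (nth os k) (nth is k) c) (upTo (length is)) ∨ above c (nth os (length is))) ≡ ℬᴱ os is c
indexed-ℬ os is c = trans (cong (_∨ above c (nth os (length is))) (any-applyUpTo _ id (length is))) (go os is)
  where
  go : ∀ os is →
       (anyBelow (λ k → between (nth os k) (nth is k) c) (length is) ∨ above c (nth os (length is))) ≡ ℬᴱ os is c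
  go []       []       = refl
  go (o ∷ os) []       = refl
  go []       (i ∷ is) = trans (cong (_∨ false) (anyBelow-false (λ _ → false) (length is) (λ _ → refl))) refl
  go (o ∷ os) (i ∷ is) = trans (∨-assoc ((o <ᶻ c) ∧ (c <ᶻ i)) _ _) (cong (((o <ᶻ c) ∧ (c <ᶻ i)) ∨_) (go os is))

𝒜ᴺ-false : ∀ {os is c} → All (λ i → (i <ᶻ c) ≡ false) is → 𝒜ᴺ os is c ≡ false
𝒜ᴺ-false {os}     {[]}     []       = refl
𝒜ᴺ-false {[]}     {i ∷ is} _        = refl
𝒜ᴺ-false {o ∷ os} {i ∷ is} (e ∷ es) rewrite e = 𝒜ᴺ-false {os} es

ℬᴱ-false : ∀ {os is c} → All (λ o → (o <ᶻ c) ≡ false) os → ℬᴱ os is c ≡ false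
ℬᴱ-false {[]}     {is}     []       = refl
ℬᴱ-false {o ∷ os} {[]}     (e ∷ es) = e
ℬᴱ-false {o ∷ os} {i ∷ is} (e ∷ es) rewrite e = ℬᴱ-false {os} {is} es

ℬᴱ-first : ∀ {o} os is {c} → (o <ᶻ c) ≡ true → ℬᴱ (o ∷ os) is c ≡ ℬᴺ os is c
ℬᴱ-first os []       e = e
ℬᴱ-first os (i ∷ is) e rewrite e = refl

-- Integer contents and strictly increasing lists

content-shift : ∀ i j k → ℤ.+ (j + k) ℤ.+ (ℤ.- (ℤ.+ i) ℤ.- ℤ.+ k) ≡ content (i , j)
content-shift i j k = lem (ℤ.+ j) (ℤ.+ i) (ℤ.+ k)
  where
  lem : ∀ j i k → (j ℤ.+ k) ℤ.+ (ℤ.- i ℤ.- k) ≡ j ℤ.- i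
  lem = ℤSolver.solve-∀

content-shift′ : ∀ i k l → ℤ.+ (l + i) ℤ.+ (ℤ.- (ℤ.+ i) ℤ.- ℤ.+ k) ≡ content (k , l)
content-shift′ i k l = lem (ℤ.+ l) (ℤ.+ i) (ℤ.+ k)
  where
  lem : ∀ l i k → (l ℤ.+ i) ℤ.+ (ℤ.- i ℤ.- k) ≡ l ℤ.- k
  lem = ℤSolver.solve-∀

content-< : ∀ {i j k l} → l + i < j + k → content (k , l) ℤ.< content (i , j)
content-< {i} {j} {k} {l} lt = subst₂ ℤ._<_ (content-shift′ i k l) (content-shift i j k)
  (ℤ.+-monoˡ-< (ℤ.- (ℤ.+ i) ℤ.- ℤ.+ k) (ℤ.+<+ lt))

content-≡ : ∀ {i j k l} → j + k ≡ l + i → content (i , j) ≡ content (k , l)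
content-≡ {i} {j} {k} {l} e = trans (sym (content-shift i j k))
  (trans (cong (λ z → ℤ.+ z ℤ.+ (ℤ.- (ℤ.+ i) ℤ.- ℤ.+ k)) e) (content-shift′ i k l))

content-≡⁻ : ∀ {i j k l} → content (i , j) ≡ content (k , l) → j + k ≡ l + i
content-≡⁻ {i} {j} {k} {l} e = ≤-antisym (≮⇒≥ λ lt → ℤ.<-irrefl (sym e) (content-< {i} {j} {k} {l} lt))
                                        (≮⇒≥ λ lt → ℤ.<-irrefl e (content-< {k} {l} {i} {j} lt))

-- Each first entry is the minimum of its list, so the two coincide, and the tails again have the
-- same members. This identifies the sorted corner contents with those met along the rim.
strict-≡ : ∀ {xs ys : List ℤ} → AllPairs ℤ._<_ xs → AllPairs ℤ._<_ ys →
           (∀ {c} → c ∈ xs → c ∈ ys) → (∀ {c} → c ∈ ys → c ∈ xs) → xs ≡ ys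
strict-≡ {[]}     {[]}     _ _ f g = refl
strict-≡ {[]}     {y ∷ ys} _ _ f g with () ← g (here refl)
strict-≡ {x ∷ xs} {[]}     _ _ f g with () ← f (here refl)
strict-≡ {x ∷ xs} {y ∷ ys} (x< ∷ sx) (y< ∷ sy) f g with head≡ (f (here refl)) (g (here refl))
  where
  head≡ : x ∈ y ∷ ys → y ∈ x ∷ xs → x ≡ y
  head≡ (here e)  _         = e
  head≡ (there _) (here e)  = sym e
  head≡ (there p) (there q) = ⊥-elim (ℤ.<-asym (All.lookup y< p) (All.lookup x< q))
... | refl = cong (x ∷_) (strict-≡ sx sy
      (λ p → tail (All.lookup x< p) (f (there p))) (λ p → tail (All.lookup y< p) (g (there p))))
  where
  tail : ∀ {c zs} → x ℤ.< c → c ∈ x ∷ zs → c ∈ zs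
  tail lt (here refl) = ⊥-elim (ℤ.<-irrefl refl lt)
  tail lt (there p)   = p

-- The diagonal at position t is represented by the (possibly virtual) cell (L , t).
module Word (L : ℕ) (W : ℕ → Bool) where

  φ : ℕ → ℤ
  φ t = content (L , t)

  φ-< : ∀ {s t} → s < t → φ s ℤ.< φ t
  φ-< {s} {t} lt = content-< {L} {t} {L} {s} (+-monoˡ-< L lt)

  φ-true : ∀ {s t} → s < t → (φ s <ᶻ φ t) ≡ true
  φ-true {s} {t} lt = dec-true (φ s ℤ.<? φ t) (φ-< lt)

  φ-false : ∀ {s t} → t ≤ s → (φ s <ᶻ φ t) ≡ false
  φ-false {s} {t} le = dec-false (φ s ℤ.<? φ t) λ lt → case (m≤n⇒m<n∨m≡n le) lt
    where
    case : t < s ⊎ t ≡ s → ¬ (φ s ℤ.< φ t)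
    case (inj₁ t<s)  lt = ℤ.<-asym (φ-< t<s) lt
    case (inj₂ refl) lt = ℤ.<-irrefl refl lt

  φ-≢ : ∀ {s t} → s < t → (φ s ≡ᶻ φ t) ≡ false
  φ-≢ {s} {t} lt = dec-false (φ s ℤ.≟ φ t) λ e → ℤ.<-irrefl e (φ-< lt)

  collect : (ℕ → Bool) → ℕ → ℕ → List ℤ
  collect f t zero    = []
  collect f t (suc n) = if f t then φ t ∷ collect f (suc t) n else collect f (suc t) n

  collect-All : ∀ {P : ℤ → Set} f t n → (∀ {s} → t ≤ s → P (φ s)) → All P (collect f t n)
  collect-All f t zero    h = []
  collect-All f t (suc n) h with f t
  ... | true  = h ≤-refl ∷ collect-All f (suc t) n (h ∘ ≤-trans (n≤1+n t))
  ... | false = collect-All f (suc t) n (h ∘ ≤-trans (n≤1+n t))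

  collect-sorted : ∀ f t n → AllPairs ℤ._<_ (collect f t n)
  collect-sorted f t zero    = []
  collect-sorted f t (suc n) with f t
  ... | true  = collect-All f (suc t) n φ-< ∷ collect-sorted f (suc t) n
  ... | false = collect-sorted f (suc t) n

  ∈-collect⁻ : ∀ f t n {c} → c ∈ collect f t n → ∃[ s ] (t ≤ s × s < t + n × f s ≡ true × c ≡ φ s)
  ∈-collect⁻ f t (suc n) p with f t in eq
  ∈-collect⁻ f t (suc n) (here refl) | true = t , ≤-refl , m<m+n t (s≤s z≤n) , eq , refl
  ∈-collect⁻ f t (suc n) (there p)   | true with ∈-collect⁻ f (suc t) n p
  ... | s , t<s , s< , e , e' = s , <⇒≤ t<s , subst (s <_) (sym (+-suc t n)) s< , e , e'
  ∈-collect⁻ f t (suc n) p           | false with ∈-collect⁻ f (suc t) n p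
  ... | s , t<s , s< , e , e' = s , <⇒≤ t<s , subst (s <_) (sym (+-suc t n)) s< , e , e'

  ∈-collect⁺ : ∀ f t n {s} → t ≤ s → s < t + n → f s ≡ true → φ s ∈ collect f t n
  ∈-collect⁺ f t zero    {s} t≤s s< e = ⊥-elim (<⇒≱ (subst (s <_) (+-identityʳ t) s<) t≤s)
  ∈-collect⁺ f t (suc n) {s} t≤s s< e with m≤n⇒m<n∨m≡n t≤s
  ... | inj₂ refl rewrite e = here refl
  ... | inj₁ t<s with f t | ∈-collect⁺ f (suc t) n t<s (subst (s <_) (+-suc t n) s<) e
  ... | true  | p = there p
  ... | false | p = p

  elem-collect : ∀ f t n {s} → t ≤ s → s < t + n → elemᶻ (φ s) (collect f t n) ≡ f s
  elem-before : ∀ f t n {s} → s < t → elemᶻ (φ s) (collect f t n) ≡ false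
  elem-before f t zero    lt = refl
  elem-before f t (suc n) lt with f t
  ... | true  rewrite φ-≢ lt = elem-before f (suc t) n (≤-trans lt (n≤1+n t))
  ... | false = elem-before f (suc t) n (≤-trans lt (n≤1+n t))
  elem-collect f t zero    {s} t≤s s< = ⊥-elim (<⇒≱ (subst (s <_) (+-identityʳ t) s<) t≤s)
  elem-collect f t (suc n) {s} t≤s s< with m≤n⇒m<n∨m≡n t≤s
  ... | inj₂ refl with f t
  ...   | true  rewrite dec-true (φ t ℤ.≟ φ t) refl = refl
  ...   | false = elem-before f (suc t) n ≤-refl
  elem-collect f t (suc n) {s} t≤s s< | inj₁ t<s with f t
  ...   | true  rewrite dec-false (φ s ℤ.≟ φ t) (λ e → ℤ.<-irrefl (sym e) (φ-< t<s)) =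
            elem-collect f (suc t) n t<s (subst (s <_) (+-suc t n) s<)
  ...   | false = elem-collect f (suc t) n t<s (subst (s <_) (+-suc t n) s<)

  -- `W t` stands for the rim entering position `t` by a north step. Leaving `t` is entering
  -- `suc t`, so two consecutive letters give the type of a diagonal.
  outerAt innerAt aAt bAt : ℕ → Bool
  outerAt t = not (W t) ∧ W (suc t)
  innerAt t = W t ∧ not (W (suc t))
  aAt     t = not (W t) ∧ not (W (suc t))
  bAt     t = W t ∧ W (suc t)

  os is : ℕ → ℕ → List ℤ
  os = collect outerAt
  is = collect innerAt

  -- The steps turn from east to north somewhere, and the first such turn is an outer corner.
  os-nonempty : ∀ t n → W t ≡ false → W (t + n) ≡ true → ∃[ o ] ∃[ os' ] (os t n ≡ o ∷ os')
  os-nonempty t zero e e' with () ← trans (sym e) (trans (cong W (sym (+-identityʳ t))) e')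
  os-nonempty t (suc n) e e' rewrite e with W (suc t) in eq
  ... | true  = _ , _ , refl
  ... | false = os-nonempty (suc t) n eq (trans (cong W (sym (+-suc t n))) e')

  Classified : Bool → ℕ → ℕ → ℕ → Set
  Classified false t n s = 𝒜ᴱ (os t n) (is t n) (φ s) ≡ aAt s × ℬᴱ (os t n) (is t n) (φ s) ≡ bAt s
  Classified true  t n s = 𝒜ᴺ (os t n) (is t n) (φ s) ≡ aAt s × ℬᴺ (os t n) (is t n) (φ s) ≡ bAt s

  >t : ∀ f t n → All (λ c → (c <ᶻ φ t) ≡ false) (collect f (suc t) n)
  >t f t n = collect-All f (suc t) n (φ-false ∘ <⇒≤)

  first-above : ∀ f t n {c cs} → collect f (suc t) n ≡ c ∷ cs → (φ t <ᶻ c) ≡ true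
  first-above f t n eq with collect f (suc t) n | collect-All {λ c → (φ t <ᶻ c) ≡ true} f (suc t) n φ-true
  first-above f t n refl | _ | e ∷ _ = e

  -- Induction along the rim. For a later position, a corner at `t` only switches the state of the
  -- scan. For `t` itself, no corner still to be scanned has smaller content, so the next comparison
  -- decides. As the word ends with a north step, an outer corner is ahead whenever the state is
  -- east.
  classify : ∀ n t → W (t + n) ≡ true → ∀ {s} → t ≤ s → s < t + n → Classified (W t) t n s
  classify zero    t end {s} t≤s s< = ⊥-elim (<⇒≱ (subst (s <_) (+-identityʳ t) s<) t≤s)
  classify (suc n) t end {s} t≤s s< with m≤n⇒m<n∨m≡n t≤s
  ... | inj₁ t<s with W t in e | W (suc t) in e'
                    | classify n (suc t) (trans (cong W (sym (+-suc t n))) end) t<s (subst (s <_) (+-suc t n) s<)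
  ...   | false | false | ih rewrite e | e' = ih
  ...   | true  | true  | ih rewrite e | e' = ih
  ...   | false | true  | a , b rewrite e | e' | φ-false (<⇒≤ t<s) =
            a , trans (ℬᴱ-first (os (suc t) n) (is (suc t) n) (φ-true t<s)) b
  ...   | true  | false | a , b rewrite e | e' | φ-false (<⇒≤ t<s) = trans (drop-first (os (suc t) n)) a , b
    where
    drop-first : ∀ os → 𝒜ᴺ os (φ t ∷ is (suc t) n) (φ s) ≡ 𝒜ᴱ os (is (suc t) n) (φ s)
    drop-first []       = refl
    drop-first (o ∷ os) rewrite φ-true t<s = refl
  classify (suc n) t end {s} t≤s s< | inj₂ refl with W t in e | W (suc t) in e'
  ...   | false | false rewrite e | e' = first , ℬᴱ-false {os (suc t) n} {is (suc t) n} (>t outerAt t n)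
    where
    first : 𝒜ᴱ (os (suc t) n) (is (suc t) n) (φ t) ≡ true
    first with os-nonempty (suc t) n e' (trans (cong W (sym (+-suc t n))) end)
    ... | o , os' , eq rewrite eq | first-above outerAt t n eq = refl
  ...   | false | true rewrite e | e' | φ-false {t} ≤-refl =
            𝒜ᴺ-false {os (suc t) n} (>t innerAt t n) ,
            ℬᴱ-false {φ t ∷ os (suc t) n} {is (suc t) n} (φ-false {t} ≤-refl ∷ >t outerAt t n)
  ...   | true  | false rewrite e | e' | φ-false {t} ≤-refl =
            𝒜ᴺ-false {os (suc t) n} {φ t ∷ is (suc t) n} (φ-false {t} ≤-refl ∷ >t innerAt t n) ,
            ℬᴱ-false {os (suc t) n} {is (suc t) n} (>t outerAt t n)
  ...   | true  | true rewrite e | e' = 𝒜ᴺ-false {os (suc t) n} (>t innerAt t n) , first (is (suc t) n) refl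
    where
    first : ∀ cs → is (suc t) n ≡ cs → ℬᴺ (os (suc t) n) cs (φ t) ≡ true
    first []       eq = refl
    first (c ∷ cs) eq rewrite first-above innerAt t n eq = refl

-- The diagram of a partition

part-anti : ∀ {sh i k} → Linked _≥_ sh → 1 ≤ i → i ≤ k → part sh k ≤ part sh i
part-anti {[]} _ _ _ = z≤n
part-anti {x ∷ xs} {suc zero} {suc zero} _ _ _ = ≤-refl
part-anti {x ∷ []} {suc zero} {suc (suc k)} _ _ _ = z≤n
part-anti {x ∷ y ∷ ys} {suc zero} {suc (suc k)} (x≥y ∷ l) _ _ = ≤-trans (part-anti {i = 1} {suc k} l ≤-refl (s≤s z≤n)) x≥y
part-anti {x ∷ []} {suc (suc i)} {suc (suc k)} _ _ _ = z≤n
part-anti {x ∷ y ∷ ys} {suc (suc i)} {suc (suc k)} (_ ∷ l) _ (s≤s le) = part-anti l (s≤s z≤n) le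
part-anti {x ∷ xs} {suc (suc i)} {suc zero} _ _ (s≤s ())

part-positive : ∀ {sh i} → All (1 ≤_) sh → 1 ≤ i → i ≤ length sh → 1 ≤ part sh i
part-positive {i = suc zero}    (q ∷ _)  _ _        = q
part-positive {i = suc (suc i)} (_ ∷ qs) _ (s≤s le) = part-positive qs (s≤s z≤n) le

part-beyond : ∀ {sh i} → length sh < i → part sh i ≡ 0
part-beyond {[]}     _ = refl
part-beyond {x ∷ xs} {suc (suc i)} (s≤s lt) = part-beyond {xs} lt

Unique-map : ∀ {A B : Set} {P : A → Set} {f : A → B} → (∀ {x y} → P x → P y → f x ≡ f y → x ≡ y) →
             ∀ {xs} → All P xs → Unique xs → Unique (map f xs)
Unique-map inj []       []       = []
Unique-map inj (p ∷ ps) (u ∷ us) =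
  All.map⁺ (All.zipWith (λ (q , ne) e → ne (inj p q e)) (ps , u)) ∷ Unique-map inj ps us

sort-strict : ∀ {xs} → Unique xs → AllPairs ℤ._<_ (sort xs)
sort-strict {xs} u = AllPairs.zipWith (λ (le , ne) → ℤ.≤∧≢⇒< le ne)
  ( Linked⇒AllPairs ℤ.≤-trans (sort-↗ xs)
  , Permutation.Unique-resp-↭ (setoid ℤ) (↭⇒↭ₛ (↭-sym (sort-↭ xs))) u )

does-true : ∀ {P : Set} (P? : Dec P) → does P? ≡ true → P
does-true (yes p) _ = p

does-false : ∀ {P : Set} (P? : Dec P) → does P? ≡ false → ¬ P
does-false (no ¬p) _ = ¬p

module Partition (sh : List ℕ) (isPartition : IsPartition sh) where

  anti : ∀ {i k} → 1 ≤ i → i ≤ k → part sh k ≤ part sh i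
  anti = part-anti (proj₁ isPartition)

  open Diagram (part sh) anti public

  L X : ℕ
  L = length sh
  X = part sh 1

  row≤L : ∀ {u} → In u → proj₁ u ≤ L
  row≤L (1≤i , 1≤j , j≤) = ≮⇒≥ λ lt → n≮0 (subst (1 ≤_) (part-beyond {sh} lt) (≤-trans 1≤j j≤))

  In⇒∈λ : ∀ {u} → In u → u ∈λ sh
  In⇒∈λ (1≤i , 1≤j , j≤) = Equivalence.from T-∧ (≤⇒≤ᵇ 1≤i , Equivalence.from T-∧ (≤⇒≤ᵇ 1≤j , ≤⇒≤ᵇ j≤))

  ∈λ⇒In : ∀ {u} → u ∈λ sh → In u
  ∈λ⇒In {i , j} t with Equivalence.to (T-∧ {1 ≤ᵇ i}) t
  ... | a , t' with Equivalence.to (T-∧ {1 ≤ᵇ j}) t'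
  ... | b , c = ≤ᵇ⇒≤ 1 i a , ≤ᵇ⇒≤ 1 j b , ≤ᵇ⇒≤ j _ c

  T-not⁺ : ∀ {b} → ¬ T b → T (not b)
  T-not⁺ {true}  f = ⊥-elim (f tt)
  T-not⁺ {false} f = tt

  T-not⁻ : ∀ {b} → T (not b) → ¬ T b
  T-not⁻ {false} _ ()

  ∉λ⇒¬In : ∀ {u} → u ∉λ sh → ¬ In u
  ∉λ⇒¬In t inu = T-not⁻ t (In⇒∈λ inu)

  ¬In⇒∉λ : ∀ {u} → ¬ In u → u ∉λ sh
  ¬In⇒∉λ ¬i = T-not⁺ (¬i ∘ ∈λ⇒In)

  abstract
    Nin? : ∀ u → Dec (Nin u)
    -- A witness satisfies `r ≤ r + j = 1 + part sh r + i ≤ 1 + X + i`, which bounds the search.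
    Nin? (i , j) = map′ (λ (r , _ , q) → r , q)
      (λ (r , 1≤r , e) → r , s≤s (≤-trans (m≤m+n r j)
        (≤-trans (≤-reflexive (sym e)) (s≤s (+-monoˡ-≤ i (anti ≤-refl 1≤r))))) , 1≤r , e)
      (anyUpTo? (λ r → (1 ≤? r) ×-dec (suc (part sh r + i) ≟ r + j)) (suc (suc (X + i))))

  W : ℕ → Bool
  W t = does (Nin? (L , t))

  open Word L W

  W-true : ∀ {t} → Nin (L , t) → W t ≡ true
  W-true N = dec-true (Nin? _) N

  W-false : ∀ {t} → ¬ Nin (L , t) → W t ≡ false
  W-false ¬N = dec-false (Nin? _) ¬N

  W-true⁻ : ∀ {t} → W t ≡ true → Nin (L , t)
  W-true⁻ {t} = does-true (Nin? (L , t))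

  W-false⁻ : ∀ {t} → W t ≡ false → ¬ Nin (L , t)
  W-false⁻ {t} = does-false (Nin? (L , t))

  -- A north step entering position 1 would be a row end of content `-L`. The rows up to `L` are
  -- nonempty and end with larger content; those past `L` give smaller content.
  W-first : 1 ≤ X → W 1 ≡ false
  W-first 1≤X = W-false λ (r , 1≤r , e) → absurd r 1≤r (suc-injective (trans e (+-comm r 1)))
    where
    absurd : ∀ r → 1 ≤ r → part sh r + L ≢ r
    absurd r 1≤r e with r ≤? L
    ... | yes r≤L = <⇒≱ (<-≤-trans (m<n+m L (part-positive (proj₂ isPartition) 1≤r r≤L)) (≤-reflexive e)) r≤L
    ... | no r≰L = r≰L (≤-reflexive (trans (sym e) (cong (_+ L) (part-beyond {sh} (≰⇒> r≰L)))))

  -- The north step of row 1 enters the position just past the last diagonal, which closes the word.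
  W-last : W (X + L) ≡ true
  W-last = W-true (1 , ≤-refl , refl)

  -- t is the position of the diagonal of u, i.e. its content plus L.
  record At (u : Cell) (t : ℕ) : Set where
    constructor at
    field
      1≤t : 1 ≤ t
      t<  : t < X + L
      eq  : proj₂ u + L ≡ t + proj₁ u

  locate : ∀ {u} → In u → ∃[ t ] At u t
  locate {i , j} inu@(1≤i , 1≤j , j≤) = t , at (≤-trans 1≤j (m≤m+n j _)) t< eq
    where
    t = j + (L ∸ i)
    eq : j + L ≡ t + i
    eq = sym (trans (+-assoc j (L ∸ i) i) (cong (j +_) (m∸n+n≡m (row≤L inu))))
    t< : t < X + L
    t< = <-≤-trans (m<m+n t 1≤i) (≤-trans (≤-reflexive (sym eq))
           (+-monoˡ-≤ L (≤-trans j≤ (anti ≤-refl 1≤i))))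

  Nin-at : ∀ {u t} → At u t → Nin u → Nin (L , t)
  Nin-at a = Nin-diagonal (At.eq a)

  Nin-at⁻ : ∀ {u t} → At u t → Nin (L , t) → Nin u
  Nin-at⁻ a = Nin-diagonal (sym (At.eq a))

  Nout-at : ∀ {u t} → At u t → Nout u → Nin (L , suc t)
  Nout-at {i , j} {t} a (r , 1≤r , e) =
    Nin-diagonal {i} {suc j} (cong suc (At.eq a)) (r , 1≤r , trans (cong suc e) (sym (+-suc r j)))

  Nout-at⁻ : ∀ {u t} → At u t → Nin (L , suc t) → Nout u
  Nout-at⁻ {i , j} {t} a N = Nin-east⇒Nout {i , j} (Nin-diagonal {L} {suc t} {i} {suc j} (cong suc (sym (At.eq a))) N)

  content-at : ∀ {u t} → At u t → content u ≡ φ t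
  content-at {i , j} {t} a = content-≡ {i} {j} {L} {t} (At.eq a)

  -- Cells and corners of the diagram

  rowCells : ℕ → List Cell
  rowCells i = map (i ,_) (from1 (part sh i))

  ∈-cells⁺ : ∀ {u} → In u → u ∈ cells sh
  ∈-cells⁺ {suc i , suc j} inu@(_ , _ , j<) = ∈-concatMap⁺ rowCells {xs = from1 L}
    (lose (∈-map⁺ suc (∈-upTo⁺ (row≤L inu))) (∈-map⁺ (suc i ,_) (∈-map⁺ suc (∈-upTo⁺ j<))))

  ∈-cells⁻ : ∀ {u} → u ∈ cells sh → In u
  ∈-cells⁻ p with find (∈-concatMap⁻ rowCells {xs = from1 L} p)
  ... | i , i∈ , q with ∈-map⁻ suc i∈ | ∈-map⁻ (i ,_) q
  ... | i' , _ , refl | j , j∈ , refl with ∈-map⁻ suc j∈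
  ... | j' , j'∈ , refl = s≤s z≤n , s≤s z≤n , ∈-upTo⁻ j'∈

  cells-unique : Unique (cells sh)
  cells-unique = Unique.concat⁺
    (All.map⁺ (All.universal (λ i → Unique.map⁺ (cong proj₂) (from1-unique (part sh i))) (from1 L)))
    (AllPairs.map⁺ (AllPairs.map (λ ne {v} pq → ne (row (proj₁ pq) (proj₂ pq))) (from1-unique L)))
    where
    from1-unique : ∀ n → Unique (from1 n)
    from1-unique n = Unique.map⁺ suc-injective (Unique.upTo⁺ n)
    row : ∀ {i k v} {xs ys : List ℕ} → v ∈ map (i ,_) xs → v ∈ map (k ,_) ys → i ≡ k
    row p q with ∈-map⁻ _ p | ∈-map⁻ _ q
    ... | _ , _ , refl | _ , _ , refl = refl

  -- Of two distinct cells on a diagonal, the upper one has its south-east neighbour in the diagram.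
  -- Hence corner contents do not repeat.
  rim-unique : ∀ {u v} → (In u × ¬ In (eC (sC u))) → (In v × ¬ In (eC (sC v))) → content u ≡ content v → u ≡ v
  rim-unique {i , j} {k , l} (inu , ¬u) (inv , ¬v) e = cong₂ _,_ rows cols
    where
    d : j + k ≡ l + i
    d = content-≡⁻ {i} {j} {k} {l} e
    rows : i ≡ k
    rows = ≤-antisym
      (≮⇒≥ λ k<i → ¬v (In-down (s≤s z≤n) (s≤s z≤n) k<i
        (+-cancelʳ-< k l j (<-≤-trans (+-monoʳ-< l k<i) (≤-reflexive (sym d)))) inu))
      (≮⇒≥ λ i<k → ¬u (In-down (s≤s z≤n) (s≤s z≤n) i<k
        (+-cancelʳ-< i j l (<-≤-trans (+-monoʳ-< j i<k) (≤-reflexive d))) inv))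
    cols : j ≡ l
    cols = +-cancelʳ-≡ k j l (trans d (cong (l +_) rows))

  -- The indices are the membership tests for 𝒪, ℐ, 𝒜 and ℬ, so one match on how the rim enters and
  -- leaves the diagonal settles all four.
  data Kind (u : Cell) : (o i a b : Bool) → Set where
    kindO : ¬ Nin u → Nout u   → Kind u true  false false false
    kindI : Nin u   → ¬ Nout u → Kind u false true  false false
    kindA : ¬ Nin u → ¬ Nout u → Kind u false false true  false
    kindB : Nin u   → Nout u   → Kind u false false false true

  I∪A⇒Eout : ∀ {u o i a b} → Kind u o i a b → T (i ∨ a) → ¬ Nout u
  I∪A⇒Eout (kindI _ ¬M) _ = ¬M
  I∪A⇒Eout (kindA _ ¬M) _ = ¬M

  O⇒Ein : ∀ {u o i a b} → Kind u o i a b → T o → ¬ Nin u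
  O⇒Ein (kindO ¬N _) _ = ¬N

  A⇒Ein : ∀ {u o i a b} → Kind u o i a b → T a → ¬ Nin u
  A⇒Ein (kindA ¬N _) _ = ¬N

  Ein⇒O⊎A : ∀ {u o i a b} → Kind u o i a b → ¬ Nin u → T o ⊎ (T a × ¬ Nout u)
  Ein⇒O⊎A (kindO _ _)  _  = inj₁ tt
  Ein⇒O⊎A (kindA _ ¬M) _  = inj₂ (tt , ¬M)
  Ein⇒O⊎A (kindI N _)  ¬N = ⊥-elim (¬N N)
  Ein⇒O⊎A (kindB N _)  ¬N = ⊥-elim (¬N N)

  IsOuter IsInner : Cell → Set
  IsOuter u = In u × ¬ In (eC u) × ¬ In (sC u)
  IsInner u = In (eC u) × In (sC u) × ¬ In (eC (sC u))

  outer⁻ : ∀ {u} → T (outerᵇ sh u) → IsOuter u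
  outer⁻ {u} t with Equivalence.to (T-∧ {inλᵇ sh u}) t
  ... | a , t' with Equivalence.to (T-∧ {not (inλᵇ sh (eC u))}) t'
  ... | b , c = ∈λ⇒In a , ∉λ⇒¬In b , ∉λ⇒¬In c

  outer⁺ : ∀ {u} → IsOuter u → T (outerᵇ sh u)
  outer⁺ (a , b , c) = Equivalence.from T-∧ (In⇒∈λ a , Equivalence.from T-∧ (¬In⇒∉λ b , ¬In⇒∉λ c))

  inner⁻ : ∀ {u} → T (innerᵇ sh u) → IsInner u
  inner⁻ {u} t with Equivalence.to (T-∧ {inλᵇ sh (eC u)}) t
  ... | a , t' with Equivalence.to (T-∧ {inλᵇ sh (sC u)}) t'
  ... | b , c = ∈λ⇒In a , ∈λ⇒In b , ∉λ⇒¬In c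

  inner⁺ : ∀ {u} → IsInner u → T (innerᵇ sh u)
  inner⁺ (a , b , c) = Equivalence.from T-∧ (In⇒∈λ a , Equivalence.from T-∧ (In⇒∈λ b , ¬In⇒∉λ c))

  -- Corners lie on the rim, so their contents are distinct and sorting makes them strictly
  -- increasing; it then suffices to compare members.
  corners-≡ : ∀ (corner : Cell → Bool) (f : ℕ → Bool) n → 1 + n ≡ X + L →
    (∀ {u} → In u → T (corner u) → ¬ In (eC (sC u))) →
    (∀ {u t} → In u → At u t → T (corner u) → f t ≡ true) →
    (∀ {t} → 1 ≤ t → t < X + L → f t ≡ true → ∃[ u ] (In u × At u t × T (corner u))) →
    sort (map content (filterᵇ corner (cells sh))) ≡ collect f 1 n
  corners-≡ corner f n len rim to from = strict-≡
    (sort-strict (Unique-map rim-unique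
      (All.tabulate λ p → let (q , t) = ∈-filter⁻ (T? ∘ corner) {xs = cells sh} p in ∈-cells⁻ q , rim (∈-cells⁻ q) t)
      (Unique.filter⁺ (T? ∘ corner) cells-unique)))
    (collect-sorted f 1 n)
    fwd bwd
    where
    list = map content (filterᵇ corner (cells sh))
    fwd : ∀ {c} → c ∈ sort list → c ∈ collect f 1 n
    fwd p with ∈-map⁻ content (∈-resp-↭ (sort-↭ list) p)
    ... | u , q , refl with ∈-filter⁻ (T? ∘ corner) {xs = cells sh} q
    ... | u∈ , t with locate (∈-cells⁻ u∈)
    ... | s , a = subst (_∈ collect f 1 n) (sym (content-at a))
                    (∈-collect⁺ f 1 n (At.1≤t a) (subst (s <_) (sym len) (At.t< a)) (to (∈-cells⁻ u∈) a t))
    bwd : ∀ {c} → c ∈ collect f 1 n → c ∈ sort list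
    bwd p with ∈-collect⁻ f 1 n p
    ... | s , 1≤s , s< , e , refl with from 1≤s (subst (s <_) len s<) e
    ... | u , inu , a , t = ∈-resp-↭ (↭-sym (sort-↭ list))
            (subst (_∈ list) (content-at a) (∈-map⁺ content (∈-filter⁺ (T? ∘ corner) (∈-cells⁺ inu) t)))

  bool-∧ : ∀ {a b} → a ≡ true → b ≡ true → a ∧ b ≡ true
  bool-∧ refl refl = refl

  ∧-split : ∀ {a b} → a ∧ b ≡ true → a ≡ true × b ≡ true
  ∧-split {true} e = refl , e

  not-true : ∀ {a} → not a ≡ true → a ≡ false
  not-true {false} _ = refl

  row-positive : ∀ {r} → 1 ≤ r → r ≤ part sh r + L → 1 ≤ part sh r
  row-positive {r} 1≤r le with r ≤? L
  ... | yes r≤L = part-positive (proj₂ isPartition) 1≤r r≤L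
  ... | no r≰L = ⊥-elim (r≰L (≤-trans le (≤-reflexive (cong (_+ L) (part-beyond {sh} (≰⇒> r≰L))))))

  outerContents-≡ : ∀ n → 1 + n ≡ X + L → outerContents sh ≡ os 1 n
  outerContents-≡ n len = corners-≡ (outerᵇ sh) outerAt n len rim to from
    where
    rim : ∀ {u} → In u → T (outerᵇ sh u) → ¬ In (eC (sC u))
    rim {u} inu t se = proj₁ (proj₂ (outer⁻ {u} t)) (In-down (proj₁ inu) (s≤s z≤n) (n≤1+n _) ≤-refl se)
    to : ∀ {u t} → In u → At u t → T (outerᵇ sh u) → outerAt t ≡ true
    to {u} {t} inu a c with outer⁻ {u} c
    ... | _ , ¬e , ¬s = bool-∧ (cong not (W-false (foot⇒Ein inu ¬s ∘ Nin-at⁻ a))) lem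
      where
      lem : W (suc t) ≡ true
      lem = W-true (decidable-stable (Nin? _) λ ¬N → ¬e (Eout⇒east inu (¬N ∘ Nout-at {u} a)))
    from : ∀ {t} → 1 ≤ t → t < X + L → outerAt t ≡ true → ∃[ u ] (In u × At u t × T (outerᵇ sh u))
    from {t} 1≤t t< e with ∧-split {not (W t)} e
    ... | e₁ , e₂ with W-true⁻ e₂
    ... | r , 1≤r , eq = u , inu , a , outer⁺ {u} (inu , (λ (_ , _ , lt) → <-irrefl refl lt) , ¬s)
      where
      u = (r , part sh r)
      eq' : part sh r + L ≡ r + t
      eq' = suc-injective (trans eq (+-suc r t))
      inu : In u
      inu = 1≤r , row-positive 1≤r (subst (r ≤_) (sym eq') (m≤m+n r t)) , ≤-refl
      a : At u t
      a = at 1≤t t< (trans eq' (+-comm r t))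
      ¬s : ¬ In (sC u)
      -- With `sC u` in the diagram, rows `r` and `r + 1` would have equal length, and row `r + 1`
      -- would give a north step entering position `t`.
      ¬s s = W-false⁻ (not-true e₁) (Nin-at a (suc r , s≤s z≤n ,
        cong suc (trans (cong (_+ r) (≤-antisym (anti 1≤r (n≤1+n r)) (proj₂ (proj₂ s)))) (+-comm _ r))))

  innerContents-≡ : ∀ n → 1 + n ≡ X + L → innerContents sh ≡ is 1 n
  innerContents-≡ n len = corners-≡ (innerᵇ sh) innerAt n len (λ {u} _ t → proj₂ (proj₂ (inner⁻ {u} t))) to from
    where
    to : ∀ {u t} → In u → At u t → T (innerᵇ sh u) → innerAt t ≡ true
    to {u} {t} inu a c with inner⁻ {u} c
    ... | e , s , ¬se = bool-∧ lem (cong not (W-false λ N → ¬se (Nin⇒south e (out N))))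
      where
      out : Nin (L , suc t) → Nin (eC u)
      out = Nin-diagonal (cong suc (sym (At.eq a)))
      lem : W t ≡ true
      lem = W-true (decidable-stable (Nin? _) λ ¬N → ¬se (Ein⇒southeast {u} (¬N ∘ Nin-at a) s))
    from : ∀ {t} → 1 ≤ t → t < X + L → innerAt t ≡ true → ∃[ u ] (In u × At u t × T (innerᵇ sh u))
    from {t} 1≤t t< e with ∧-split {W t} e
    ... | e₁ , e₂ with W-true⁻ e₁
    -- The north step of row 1 enters position `X + L`, which is out of range.
    ... | suc zero , 1≤r , eq = ⊥-elim (<-irrefl (sym (suc-injective eq)) t<)
    -- The inner corner is the cell directly above the end of the row that gives the entering step.
    ... | suc (suc i) , 1≤r , eq = u , inu , a , inner⁺ {u}
            (Eout⇒east inu (W-false⁻ (not-true e₂) ∘ Nout-at {u} a) ,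
             (s≤s z≤n , 1≤j , ≤-refl) , λ (_ , _ , lt) → <-irrefl refl lt)
      where
      j = part sh (suc (suc i))
      u = (suc i , j)
      eq' : j + L ≡ suc i + t
      eq' = suc-injective eq
      1≤j : 1 ≤ j
      1≤j = row-positive 1≤r (subst₂ _≤_ (+-comm (suc i) 1) (sym eq') (+-monoʳ-≤ (suc i) 1≤t))
      inu : In u
      inu = s≤s z≤n , 1≤j , anti (s≤s z≤n) (n≤1+n _)
      a : At u t
      a = at 1≤t t< (trans eq' (+-comm (suc i) t))

  module _ {u t} (inu : In u) (a : At u t) where
    private
      n = X + L ∸ 1

      len : 1 + n ≡ X + L
      len = m+[n∸m]≡n (≤-trans (s≤s z≤n) (At.t< a))

      in≡ : inλᵇ sh u ≡ true
      in≡ = Equivalence.to T-≡ (In⇒∈λ inu)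

      t<1+n : t < 1 + n
      t<1+n = subst (t <_) (sym len) (At.t< a)

      1≤X : 1 ≤ X
      1≤X = ≤-trans (proj₁ (proj₂ inu)) (≤-trans (proj₂ (proj₂ inu)) (anti ≤-refl (proj₁ inu)))

      classified : Classified false 1 n t
      classified = subst (λ b → Classified b 1 n t) (W-first 1≤X)
        (classify n 1 (trans (cong W len) W-last) (At.1≤t a) t<1+n)

    isO-≡ : isO sh u ≡ outerAt t
    isO-≡ = cong₂ _∧_ in≡ (trans (cong₂ elemᶻ (content-at a) (outerContents-≡ n len))
      (elem-collect outerAt 1 n (At.1≤t a) t<1+n))

    isI-≡ : isI sh u ≡ innerAt t
    isI-≡ = cong₂ _∧_ in≡ (trans (cong₂ elemᶻ (content-at a) (innerContents-≡ n len))
      (elem-collect innerAt 1 n (At.1≤t a) t<1+n))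

    isA-≡ : isA sh u ≡ aAt t
    isA-≡ = cong₂ _∧_ in≡ (trans (indexed-𝒜 (outerContents sh) (innerContents sh) (content u))
      (trans (cong₂ (λ x y → 𝒜ᴱ x y (content u)) (outerContents-≡ n len) (innerContents-≡ n len))
      (trans (cong (𝒜ᴱ (os 1 n) (is 1 n)) (content-at a)) (proj₁ classified))))

    isB-≡ : isB sh u ≡ bAt t
    isB-≡ = cong₂ _∧_ in≡ (trans (indexed-ℬ (outerContents sh) (innerContents sh) (content u))
      (trans (cong₂ (λ x y → ℬᴱ x y (content u)) (outerContents-≡ n len) (innerContents-≡ n len))
      (trans (cong (ℬᴱ (os 1 n) (is 1 n)) (content-at a)) (proj₂ classified))))

    kindAt : Kind u (outerAt t) (innerAt t) (aAt t) (bAt t)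
    kindAt = go (Nin? (L , t)) (Nin? (L , suc t))
      where
      go : (N : Dec (Nin (L , t))) (M : Dec (Nin (L , suc t))) →
           Kind u (not (does N) ∧ does M) (does N ∧ not (does M)) (not (does N) ∧ not (does M)) (does N ∧ does M)
      go (no ¬N) (yes M) = kindO (¬N ∘ Nin-at a) (Nout-at⁻ {u} a M)
      go (yes N) (no ¬M) = kindI (Nin-at⁻ a N) (¬M ∘ Nout-at {u} a)
      go (no ¬N) (no ¬M) = kindA (¬N ∘ Nin-at a) (¬M ∘ Nout-at {u} a)
      go (yes N) (yes M) = kindB (Nin-at⁻ a N) (Nout-at⁻ {u} a M)

  kind : ∀ {u} → In u → Kind u (isO sh u) (isI sh u) (isA sh u) (isB sh u)
  kind {u} inu with locate inu
  ... | t , a = subst₂ (λ x y → Kind u x y (isA sh u) (isB sh u)) (sym (isO-≡ inu a)) (sym (isI-≡ inu a))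
                 (subst₂ (Kind u (outerAt t) (innerAt t)) (sym (isA-≡ inu a)) (sym (isB-≡ inu a)) (kindAt inu a))

-- The insertion procedure

memb⇒∈ : ∀ u P → T (memb u P) → u ∈ P
memb⇒∈ (i , j) ((k , l) ∷ P) t with Equivalence.to (T-∨ {(i ≡ᵇ k) ∧ (j ≡ᵇ l)}) t
... | inj₂ p = there (memb⇒∈ (i , j) P p)
... | inj₁ p with Equivalence.to (T-∧ {i ≡ᵇ k}) p
... | a , b = here (cong₂ _,_ (≡ᵇ⇒≡ i k a) (≡ᵇ⇒≡ j l b))

∈⇒memb : ∀ {u P} → u ∈ P → T (memb u P)
∈⇒memb {i , j} (here refl) = Equivalence.from T-∨ (inj₁ (Equivalence.from T-∧ (≡⇒≡ᵇ i i refl , ≡⇒≡ᵇ j j refl)))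
∈⇒memb {i , j} {(k , l) ∷ P} (there p) = Equivalence.from (T-∨ {(i ≡ᵇ k) ∧ (j ≡ᵇ l)}) (inj₂ (∈⇒memb p))

+P-on : ∀ π {P u} → u ∈ P → (π +P P) u ≡ suc (π u)
+P-on π {P} {u} p rewrite Equivalence.to T-≡ (∈⇒memb p) = +-comm (π u) 1

+P-off : ∀ π {P u} → ¬ (u ∈ P) → (π +P P) u ≡ π u
+P-off π {P} {u} ¬p with memb u P in eq
... | true  = ⊥-elim (¬p (memb⇒∈ u P (Equivalence.from T-≡ eq)))
... | false = +-identityʳ (π u)

lastC-snoc : ∀ P u → lastC (P ++ u ∷ []) ≡ u
lastC-snoc []           u = refl
lastC-snoc (_ ∷ [])     u = refl
lastC-snoc (_ ∷ v ∷ P)  u = lastC-snoc (v ∷ P) u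

headC-++ : ∀ {sh P Q} → NEPath sh P → headC (P ++ Q) ≡ headC P
headC-++ (single _)   = refl
headC-++ (step _ _ _) = refl

NEPath-snoc : ∀ {sh P u} → NEPath sh P → u ∈λ sh → u ≡ nC (lastC P) ⊎ u ≡ eC (lastC P) → NEPath sh (P ++ u ∷ [])
NEPath-snoc (single v∈) u∈ e = step v∈ e (single u∈)
NEPath-snoc (step v∈ d p) u∈ e = step v∈ d (NEPath-snoc p u∈ e)

NEPath-first : ∀ {sh P} → NEPath sh P → α P ∈λ sh
NEPath-first (single u∈)   = u∈
NEPath-first (step u∈ _ _) = u∈

NEPath-last : ∀ {sh P} → NEPath sh P → ω P ∈λ sh
NEPath-last (single u∈)  = u∈
NEPath-last (step _ _ p) = NEPath-last p

module Insertion (sh : List ℕ) (isPartition : IsPartition sh) where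
  open Partition sh isPartition

  NEPath-content : ∀ {P} → NEPath sh P → Ahead (α P) (ℓ P) (ω P)
  NEPath-content (single {i , j} _) = sym (+-identityʳ _)
  NEPath-content (step {zero , j} () _ _)
  NEPath-content {P} (step {suc i , j} {rest = rest} u∈ (inj₁ refl) p) =
    trans (+-suc _ i) (trans (cong suc (NEPath-content p)) (sym (+-suc _ (length rest))))
  NEPath-content {P} (step {suc i , j} {rest = rest} u∈ (inj₂ refl) p) =
    trans (NEPath-content p) (sym (+-suc _ (length rest)))

  hookEnds : ∀ {h} → IsRimHook sh h → IsHookEnds (α h) (ω h) (ℓ h)
  hookEnds (path , foot , end , _) = record
    { in-x = ∈λ⇒In (NEPath-first path) ; foot = ∉λ⇒¬In foot
    ; in-w = ∈λ⇒In (NEPath-last path) ; rowEnd = ∉λ⇒¬In end ; ahead = NEPath-content path }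

  val-In : ∀ π {u} → In u → val sh π u ≡ fin (π u)
  val-In π {suc i , suc j} inu rewrite Equivalence.to T-≡ (In⇒∈λ inu) = refl

  val-out : ∀ π {i j} → ¬ In (suc i , suc j) → val sh π (suc i , suc j) ≡ ∞
  val-out π {i} {j} ¬in with inλᵇ sh (suc i , suc j) in eq
  ... | true  = ⊥-elim (¬in (∈λ⇒In (Equivalence.from T-≡ eq)))
  ... | false = refl

  -- π is a function on all of ℕ × ℕ; this makes it agree with the convention π = 0 off the quadrant.
  Grounded : (Cell → ℕ) → Set
  Grounded π = ∀ i → π (i , 0) ≡ 0 × π (0 , i) ≡ 0

  val-west : ∀ {π} → Grounded π → ∀ {u} → In u → val sh π (wC u) ≡ fin (π (wC u))
  val-west g {suc i , suc zero} _ = cong fin (sym (proj₁ (g (suc i))))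
  val-west {π} g {suc i , suc (suc j)} (_ , _ , le) = val-In π (s≤s z≤n , s≤s z≤n , ≤-trans (n≤1+n _) le)

  val-north : ∀ {π} → Grounded π → ∀ {u} → In u → val sh π (nC u) ≡ fin (π (nC u))
  val-north g {suc zero , j} _ = cong fin (sym (proj₂ (g j)))
  val-north {π} g {suc (suc i) , suc j} inu = val-In π (In-down (s≤s z≤n) (s≤s z≤n) (n≤1+n _) ≤-refl inu)

  In? : ∀ u → Dec (In u)
  In? u = map′ ∈λ⇒In In⇒∈λ (T? (inλᵇ sh u))

  Mono⇒RPP : ∀ {π} → Mono π → IsRPP sh π
  Mono⇒RPP {π} mono u@(suc i , suc j) u∈ =
    subst (_≤∞ val sh π (eC u)) (sym (val-In π (∈λ⇒In u∈))) toEast ,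
    subst (_≤∞ val sh π (sC u)) (sym (val-In π (∈λ⇒In u∈))) toSouth
    where
    toEast : fin (π u) ≤∞ val sh π (eC u)
    toEast with In? (eC u)
    ... | yes e = subst (fin (π u) ≤∞_) (sym (val-In π e)) (proj₁ (mono e))
    ... | no ¬e = subst (fin (π u) ≤∞_) (sym (val-out π ¬e)) tt
    toSouth : fin (π u) ≤∞ val sh π (sC u)
    toSouth with In? (sC u)
    ... | yes e = subst (fin (π u) ≤∞_) (sym (val-In π e)) (proj₂ (mono e))
    ... | no ¬e = subst (fin (π u) ≤∞_) (sym (val-out π ¬e)) tt

  -- Paths traced by the south-west rule

  advance : (Cell → ℕ) → Cell → Cell
  advance π u = if (isB sh u ∨ isI sh u) ∧ (val sh π u ≡∞ᵇ val sh π (sC u)) then sC u else wC u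

  -- ℬ and ℐ together are the north-entered diagonals. There `sC u` lies in the diagram, so the rule
  -- compares two finite values.
  advance-Step : ∀ π {u} → In u → Step π u (advance π u)
  advance-Step π {u} inu = go (kind inu)
    where
    turn : Nin u → Step π u (if val sh π u ≡∞ᵇ val sh π (sC u) then sC u else wC u)
    turn N rewrite val-In π inu | val-In π (Nin⇒south inu N) with π u ≡ᵇ π (sC u) in e
    ... | true  = south N (≡ᵇ⇒≡ _ _ (Equivalence.from T-≡ e))
    ... | false = westN N λ eq → subst T e (≡⇒≡ᵇ _ _ eq)
    go : ∀ {o i a b} → Kind u o i a b →
         Step π u (if (b ∨ i) ∧ (val sh π u ≡∞ᵇ val sh π (sC u)) then sC u else wC u)
    go (kindO ¬N _) = westE ¬N
    go (kindA ¬N _) = westE ¬N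
    go (kindI N _)  = turn N
    go (kindB N _)  = turn N

  run : (Cell → ℕ) → Cell → ℕ → Cell
  run π u zero    = u
  run π u (suc t) = run π (advance π u) t

  run-suc : ∀ π u t → run π u (suc t) ≡ advance π (run π u t)
  run-suc π u zero    = refl
  run-suc π u (suc t) = run-suc π (advance π u) t

  trail : ∀ π u → Trail π u (run π u)
  trail π u = record { start = refl
    ; next = λ t inu → subst (Step π (run π u t)) (sym (run-suc π u t)) (advance-Step π inu) }

  ∈-swRule⁺ : ∀ π n u {v} → OnTrail (run π u) n v → v ∈ swRule sh π n u
  ∈-swRule⁺ π zero    u (zero , _ , refl)            = here refl
  ∈-swRule⁺ π (suc n) u (zero , _ , refl)            = here refl
  ∈-swRule⁺ π (suc n) u (suc t , s≤s t≤n , eq) = there (∈-swRule⁺ π n (advance π u) (t , t≤n , eq))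

  ∈-swRule⁻ : ∀ π n u {v} → v ∈ swRule sh π n u → OnTrail (run π u) n v
  ∈-swRule⁻ π zero    u (here refl) = 0 , z≤n , refl
  ∈-swRule⁻ π (suc n) u (here refl) = 0 , z≤n , refl
  ∈-swRule⁻ π (suc n) u (there p) with ∈-swRule⁻ π n (advance π u) p
  ... | t , t≤n , eq = suc t , s≤s t≤n , eq

  module _ (π : Cell → ℕ) (n : ℕ) (u : Cell) where

    path : List Cell
    path = reverse (swRule sh π n u)

    ∈-path⁺ : ∀ {v} → OnTrail (run π u) n v → v ∈ path
    ∈-path⁺ = Any.reverse⁺ ∘ ∈-swRule⁺ π n u

    ∈-path⁻ : ∀ {v} → v ∈ path → OnTrail (run π u) n v
    ∈-path⁻ = ∈-swRule⁻ π n u ∘ Any.reverse⁻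

    adds : Adds π (run π u) n (π +P path)
    adds = record
      { on? = λ v → map′ (∈-path⁻ ∘ memb⇒∈ v path) (∈⇒memb ∘ ∈-path⁺) (T? (memb v path))
      ; on  = λ t≤n → +P-on π (∈-path⁺ (_ , t≤n , refl))
      ; off = λ ¬o → +P-off π (¬o ∘ ∈-path⁻) }

  length-swRule : ∀ π n u → length (swRule sh π n u) ≡ suc n
  length-swRule π zero    u = refl
  length-swRule π (suc n) u = cong suc (length-swRule π n _)

  ℓ-path : ∀ π n u → ℓ (path π n u) ≡ n
  ℓ-path π n u = cong (_∸ 1) (trans (length-reverse (swRule sh π n u)) (length-swRule π n u))

  advance-back : ∀ π {u} → In u → u ≡ nC (advance π u) ⊎ u ≡ eC (advance π u)
  advance-back π inu = go inu (advance-Step π inu)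
    where
    go : ∀ {u v} → In u → Step π u v → u ≡ nC v ⊎ u ≡ eC v
    go             _ (south _ _) = inj₁ refl
    go {_ , suc _} _ (westN _ _) = inj₂ refl
    go {_ , suc _} _ (westE _)   = inj₂ refl

  path-NEPath : ∀ π n u → (∀ {t} → t ≤ n → In (run π u t)) →
                NEPath sh (path π n u) × ω (path π n u) ≡ u × α (path π n u) ≡ run π u n
  path-NEPath π zero    u inside = single (In⇒∈λ (inside z≤n)) , refl , refl
  path-NEPath π (suc n) u inside
    rewrite unfold-reverse u (swRule sh π n (advance π u)) with path-NEPath π n (advance π u) (inside ∘ s≤s)
  ... | p , last , first =
    NEPath-snoc p (In⇒∈λ (inside z≤n))
      (subst (λ v → u ≡ nC v ⊎ u ≡ eC v) (sym last) (advance-back π (inside z≤n))) ,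
    lastC-snoc (path π n (advance π u)) u , trans (headC-++ p) first

  -- Iterated insertion of ordered rim-hooks

  record Inserting (h : List Cell) (π : Cell → ℕ) : Set where
    field
      ends     : IsHookEnds (α h) (ω h) (ℓ h)
      outcome  : Outcome π (h *[ sh ] π) (α h) (ω h) (ℓ h) (run π (ω h))
      grounded : Grounded (h *[ sh ] π)

  ground : ∀ {h π} → Grounded π → Outcome π (h *[ sh ] π) (α h) (ω h) (ℓ h) (run π (ω h)) → Grounded (h *[ sh ] π)
  ground {h} {π} g o i =
    trans (off λ (t , t≤n , eq) → n≮0 (subst (λ v → 1 ≤ proj₂ v) eq (proj₁ (proj₂ (inside t≤n))))) (proj₁ (g i)) ,
    trans (off λ (t , t≤n , eq) → n≮0 (subst (λ v → 1 ≤ proj₁ v) eq (proj₁ (inside t≤n)))) (proj₂ (g i))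
    where
    open Adds (adds π (ℓ h) (ω h))
    open Inserted (Outcome.inserted o)

  -- The column of the indexing cell fixes the head of the hook and its row fixes the tail. The two
  -- alternatives are the cases of `insert-fresh` and `insert-again`.
  hook-order : ∀ {h h'} → h ≤[ sh ]ʰ h' →
               proj₂ (α h') < proj₂ (α h) ⊎ (α h ≡ α h' × proj₁ (ω h') ≤ proj₁ (ω h))
  hook-order ((i , j) , (k , l) , _ , _ , (a , w) , (a' , w') , inj₁ l<j) =
    inj₁ (subst₂ _<_ (sym (cong proj₂ a')) (sym (cong proj₂ a)) l<j)
  hook-order ((i , j) , (k , l) , _ , _ , (a , w) , (a' , w') , inj₂ (refl , k≤i)) =
    inj₂ (trans a (sym a') , subst₂ _≤_ (sym (cong proj₁ w')) (sym (cong proj₁ w)) k≤i)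

  inserting : ∀ {h hs} → All (IsRimHook sh) (h ∷ hs) → Linked (_≤[ sh ]ʰ_) (h ∷ hs) → Inserting h (insAll sh hs)
  inserting {h} {[]} (rh ∷ []) _ =
    record { ends = ends ; outcome = o ; grounded = ground {h} {zeroRPP} (λ _ → refl , refl) o }
    where
    ends = hookEnds rh
    -- All entries of the zero filling vanish, so depth 0 will do, and 0 is less than the column of
    -- any head.
    o = insert-fresh {b = 0} ends (trail zeroRPP (ω h)) (adds zeroRPP (ℓ h) (ω h))
          (λ _ → z≤n , z≤n) (proj₁ (proj₂ (IsHookEnds.in-x ends))) (λ _ _ → refl) (λ _ _ _ → refl)
  inserting {h} {h' ∷ hs} (rh ∷ rhs) (h≤h' ∷ linked) =
    record { ends = ends ; outcome = o ; grounded = ground {h} {π} (Inserting.grounded prev) o }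
    where
    π = insAll sh (h' ∷ hs)
    ends = hookEnds rh
    prev = inserting rhs linked
    module E = IsHookEnds ends
    module E' = IsHookEnds (Inserting.ends prev)
    ins = Outcome.inserted (Inserting.outcome prev)
    module I = Inserted ins
    case : proj₂ (α h') < proj₂ (α h) ⊎ (α h ≡ α h' × proj₁ (ω h') ≤ proj₁ (ω h)) →
           Outcome π (h *[ sh ] π) (α h) (ω h) (ℓ h) (run π (ω h))
    case (inj₁ lt) = insert-fresh ends (trail π (ω h)) (adds π (ℓ h) (ω h)) I.mono lt I.vanish
      (Flat-advance E.in-x E'.in-x E'.foot lt I.flat)
    case (inj₂ (eq , le)) = insert-again ends (trail π (ω h)) (adds π (ℓ h) (ω h))
      (subst (λ x → IsHookEnds x (ω h') (ℓ h')) (sym eq) (Inserting.ends prev))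
      (subst (λ x → Inserted π x (ω h') (ℓ h') (run (insAll sh hs) (ω h'))) (sym eq) ins) le
    o = case (hook-order {h} {h'} h≤h')

  module _ {h π} (I : Inserting h π) where
    open Inserting I
    open Outcome outcome
    open Inserted inserted using (inside; mono; flat; pos)
    private
      n = ℓ h
      P = insPath sh h π
      π' = h *[ sh ] π
      q = run π (ω h)
      isPath = path-NEPath π n (ω h) inside
      q-In : ∀ {u} → OnTrail q n u → In u
      q-In (_ , t≤n , refl) = inside t≤n

    inserts : Inserts sh h π
    inserts = P , proj₁ isPath , proj₁ (proj₂ isPath) , ℓ-path π n (ω h) , (east , southw) , Mono⇒RPP mono
      where
      to = ∈-path⁻ π n (ω h)
      east : ∀ u → u ∈ P → T (isI sh u ∨ isA sh u) → eC u ∈ P × π u ≡ π (eC u)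
      east u u∈ t = Product.map₁ (∈-path⁺ π n (ω h)) (compatible-east (to u∈) (I∪A⇒Eout (kind (q-In (to u∈))) t))
      southw : ∀ u → u ∈ P → sC u ∈ P → π u ≡ π (sC u)
      southw u a b = compatible-south (to a) (to b)

    -- Every candidate lies on an east-entered diagonal and exceeds its western neighbour. Flatness
    -- of the result forbids this for greater contents, and on the diagonal of the head below the
    -- end of the path.
    minimal : IsMinCand sh π' (α P)
    minimal = subst (IsMinCand sh π') (sym (proj₂ (proj₂ isPath))) (cand , least)
      where
      in-end = inside ≤-refl
      west< : val sh π' (wC (q n)) <∞ fin (π' (q n))
      west< = subst (_<∞ fin (π' (q n))) (sym (val-west {π'} grounded in-end)) end>west
      cand : Cand sh π' (q n)
      cand = Sum.map (_, west<)
        (λ (a , ¬N) → a , west< , subst (_<∞ fin (π' (q n))) (sym (val-north {π'} grounded in-end)) (end>north ¬N))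
        (Ein⇒O⊎A (kind in-end) end-Ein)
      a = proj₁ (α h)
      b = proj₂ (α h)
      i = proj₁ (q n)
      j = proj₂ (q n)
      at-end : j + a ≡ b + i
      at-end = trans (pos (+-identityʳ n)) (+-identityʳ _)
      shuffle : ∀ l a b i → (l + a) + (b + i) ≡ (l + i) + (a + b)
      shuffle = solve-∀
      shuffle′ : ∀ b k a j → (b + k) + (j + a) ≡ (j + k) + (a + b)
      shuffle′ = solve-∀
      diagonals : ∀ {v} → ¬ Beyond (α h) (proj₁ (q n)) v → q n ⊴ v
      diagonals {k , l} ¬bey with <-cmp (l + a) (b + k)
      -- Combining the comparison for `v` with the equation `at-end` lets the coordinates of the
      -- head cancel.
      ... | tri< lt _ _ = inj₁ (content-< {i} {j} {k} {l} (+-cancelʳ-< (a + b) _ _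
              (subst₂ _<_ (shuffle l a b i) (shuffle′ b k a j) (+-mono-<-≤ lt (≤-reflexive (sym at-end))))))
      ... | tri≈ _ e _ = inj₂
              ( content-≡ {i} {j} {k} {l} (+-cancelʳ-≡ (a + b) _ _
                  (trans (sym (shuffle′ b k a j)) (trans (cong₂ _+_ (sym e) at-end) (shuffle l a b i))))
              , ≮⇒≥ λ lt → ¬bey (inj₂ (sym e , lt)) )
      ... | tri> _ _ gt = ⊥-elim (¬bey (inj₁ gt))
      strict : ∀ {v} → In v → ¬ Nin v → val sh π' (wC v) <∞ fin (π' v) → q n ⊴ v
      strict {v} inv ¬N lt = diagonals λ bey →
        <-irrefl (sym (flat inv ¬N bey)) (subst (_<∞ fin (π' v)) (val-west {π'} grounded inv) lt)
      T-in : ∀ {v b} → T (inλᵇ sh v ∧ b) → In v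
      T-in {v} t = ∈λ⇒In (proj₁ (Equivalence.to (T-∧ {inλᵇ sh v}) t))
      least : ∀ v → Cand sh π' v → q n ⊴ v
      least v (inj₁ (o , lt)) = strict inv (O⇒Ein (kind inv) o) lt
        where inv = T-in o
      least v (inj₂ (o , lt , _)) = strict inv (A⇒Ein (kind inv) o) lt
        where inv = T-in o

mainTheorem14 : (sh : List ℕ) → IsPartition sh →
    (hs : List (List Cell)) → All (IsRimHook sh) hs → Linked (_≤[ sh ]ʰ_) hs →
    (i : Fin (length hs)) →
    Inserts sh (lookup hs i) (insAll sh (drop (suc (toℕ i)) hs))
    × IsMinCand sh (insAll sh (drop (toℕ i) hs))
    (α (insPath sh (lookup hs i) (insAll sh (drop (suc (toℕ i)) hs))))
mainTheorem14 sh isP (h ∷ hs) rims linked zero = inserts I , minimal I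
  where
  open Insertion sh isP
  I = inserting rims linked
mainTheorem14 sh isP (h ∷ hs) (_ ∷ rims) linked (suc i) = mainTheorem14 sh isP hs rims (Linked.tail linked) i
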